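{- Let $R$ be a finite commutative ring with unit whose order is a power of some prime number $p$, and let $S$ denote the set of all ideals of $R$. Then the generating function $$\mathrm{HD}(t):=\sum_{w\in\mathcal{D}(S)}\mathrm{rank}_{\mathbb{Z}}\bigl(\mathrm{Spl}_R(T(w))\bigr)\,t^{|E_{T(w)}|}$$ is algebraic, where $\mathrm{rank}_{\mathbb{Z}}(\mathrm{Spl}_R(T(w)))$ denotes the size of a $\mathbb{Z}$-basis of $\mathrm{Spl}_R(T(w))$.
   Context: For a module $M$ over a finite ring $R$, a $\mathbb{Z}$-basis of $M$ means a set of elements of smallest possible size that generates $M$ as a $\mathbb{Z}$-module (abelian group); so $\mathrm{rank}_{\mathbb{Z}}(M)$ is the minimal number of generators of $M$ as an abelian group. The Dyck language $\mathcal{D}(S)$ is the set of words (including the empty word) in the alphabet $\{(_\alpha,\,)_\alpha\mid\alpha\in S\}$ that are properly nested sequences of parentheses, each left parenthesis being closed by a right parenthesis with the same label. For $w\in\mathcal{D}(S)$ the planar rooted tree $T(w)$ with edge-labels in $S$ is defined recursively: the empty word gives the one-vertex tree; if $w=(_{\alpha_1}w_1)_{\alpha_1}\cdots(_{\alpha_m}w_m)_{\alpha_m}$ with $w_i\in\mathcal{D}(S)$, then $T(w)$ has $m$ edges out of its root, labeled $\alpha_1,\dots,\alpha_m$ from left to right, the $i$-th one attached to the root of $T(w_i)$. This is a bijection between $\mathcal{D}(S)$ and planar rooted trees with edge-labels in $S$; $|E_{T(w)}|$, the number of edges of $T(w)$, is half the length of $w$. For a tree $T$ with vertex set $V_T$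 and edges labeled by ideals of $R$ via $\alpha$, $\mathrm{Spl}_R(T)$ is the $R$-module of all $\mathbf p\in\bigoplus_{v\in V_T}R$ with $\mathbf p_u-\mathbf p_v\in\alpha(e)$ for each edge $e$ with endpoints $u,v$. A formal power series $F(t)$ is algebraic if there is a nonzero polynomial $P(x,t)$ with rational coefficients such that $P(F(t),t)=0$. -}

module Defs where

open import Level using (Level; _⊔_)
open import Algebra.Bundles using (AbelianGroup; CommutativeRing)
open import Algebra.Module.Bundles using (Module)
import Algebra.Definitions.RawMonoid as RawMonoidDefinitions
import Algebra.Properties.AbelianGroup as AbelianGroupProperties
import Algebra.Properties.CommutativeMonoid.Mult as CommutativeMonoidMult
import Algebra.Properties.CommutativeMonoid.Sum as CommutativeMonoidSum
import Algebra.Properties.Ring as RingProperties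
open import Data.Bool.Properties using () renaming (_≟_ to _≟ᵇ_)
open import Data.Empty using (⊥-elim)
open import Data.Fin.Base using (Fin; zero; suc; toℕ; fromℕ<; finToFun; funToFin)
import Data.Fin.Properties as Fin
open import Data.Fin.Subset using (Subset; inside; outside) renaming (_∈_ to _∈ˢ_)
open import Data.Fin.Subset.Properties using () renaming (_∈?_ to _∈ˢ?_)
open import Data.Integer.Base using (ℤ; +_; -[1+_])
open import Data.List.Base using (List; []; _∷_; _++_; map; concatMap; cartesianProductWith; filter; deduplicate; allFin; length; lookup)
import Data.List.Properties as List
open import Data.List.Membership.Propositional using (_∈_)
open import Data.List.Membership.Propositional.Properties
  using (∈-map⁺; ∈-concatMap⁺; ∈-cartesianProductWith⁺; ∈-filter⁺; ∈-filter⁻; ∈-deduplicate⁺; ∈-allFin)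
open import Data.List.Relation.Unary.All as All using (All)
open import Data.List.Relation.Unary.Any as Any using (Any; here; there)
open import Data.List.Relation.Unary.Any.Properties using (lookup-index)
open import Data.List.Relation.Unary.Unique.Propositional using (Unique)
import Data.List.Relation.Unary.Unique.Propositional.Properties as Unique
import Data.List.Relation.Unary.Unique.DecPropositional.Properties as DecUnique
open import Data.Nat.Base as ℕ using (ℕ; zero; suc; _≤_; z≤n; s≤s)
open import Data.Nat.DivMod using (_/_; _%_; m≡m%n+[m/n]*n; m%n<n)
open import Data.Nat.ListAction using (sum)
import Data.Nat.Properties as ℕ
open import Data.Product.Base using (∃; _×_; _,_; proj₁; proj₂)
open import Data.Rational.Base as ℚ using (ℚ; 0ℚ)
open import Data.Vec.Base using ([]; _∷_)
import Data.Vec.Properties as Vec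
open import Function.Base using (_∘_)
open import Function.Bundles using (Inverse)
open import Relation.Binary.Bundles using (Setoid)
open import Relation.Binary.Definitions using (DecidableEquality)
import Relation.Binary.Definitions as B
open import Relation.Binary.PropositionalEquality as ≡ using (_≡_; _≢_; refl; cong; cong₂; subst)
import Relation.Binary.Reasoning.Setoid as SetoidReasoning
open import Relation.Nullary using (Dec; yes; no)
open import Relation.Nullary.Decidable using (map′; recompute; _×-dec_; _→-dec_)
open import Relation.Unary using (Pred; Decidable)

private
  variable
    a s c ℓ m ℓm p : Level

record Enumeration {A : Set a} (P : Pred A p) : Set (a ⊔ p) where
  field
    elements : List A
    unique   : Unique elements
    sound    : ∀ {x} → x ∈ elements → P x
    complete : ∀ {x} → P x → x ∈ elements

∑ : {A : Set a} {P : Pred A p} → Enumeration P → (A → ℕ) → ℕ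
∑ E f = sum (map f (Enumeration.elements E))

enumerate : {A : Set a} {P : Pred A p} → DecidableEquality A → Decidable P →
            (xs : List A) → (∀ {x} → P x → x ∈ xs) → Enumeration P
enumerate _≟_ P? xs complete = record
  { elements = filter P? (deduplicate _≟_ xs)
  ; unique   = Unique.filter⁺ P? (DecUnique.deduplicate-! _≟_ xs)
  ; sound    = λ x∈ → proj₂ (∈-filter⁻ P? {xs = deduplicate _≟_ xs} x∈)
  ; complete = λ px → ∈-filter⁺ P? (∈-deduplicate⁺ _≟_ (complete px)) px
  }

data Paren (S : Set s) : Set s where
  left right : S → Paren S

data Dyck {S : Set s} : List (Paren S) → Set s where
  empty : Dyck []
  nest  : ∀ α {u v} → Dyck u → Dyck v → Dyck (left α ∷ u ++ right α ∷ v)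

record DyckWord (S : Set s) : Set s where
  constructor mkDyckWord
  field
    {word} : List (Paren S)
    isDyck : Dyck word

module _ {S : Set s} where

  -- A word has at most one derivation, so a sum over `DyckWord S` counts each
  -- word of the language once.

  Dyck-prefix : ∀ {u u′ : List (Paren S)} {α β x y} → Dyck u → Dyck u′ →
                u ++ right α ∷ x ≡ u′ ++ right β ∷ y → u ≡ u′ × x ≡ y
  Dyck-prefix empty empty refl = refl , refl
  Dyck-prefix {x = x} {y = y} (nest α {u₁} {v₁} d e) (nest β {u₂} {v₂} d′ e′) eq
    with List.∷-injective eq
  ... | refl , eq₁ with Dyck-prefix {x = v₁ ++ _} {y = v₂ ++ _} d d′
                         (≡.trans (≡.sym (List.++-assoc u₁ _ _))
                           (≡.trans eq₁ (List.++-assoc u₂ _ _)))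
  ... | refl , eq₂ with Dyck-prefix e e′ eq₂
  ... | refl , eq₃ = refl , eq₃

  Dyck-irrelevant′ : ∀ {w w′ : List (Paren S)} (d : Dyck w) (d′ : Dyck w′) →
                     w ≡ w′ → mkDyckWord d ≡ mkDyckWord d′
  Dyck-irrelevant′ empty empty refl = refl
  Dyck-irrelevant′ (nest α d e) (nest β d′ e′) eq
    with List.∷-injective eq
  ... | refl , eq₁ with Dyck-prefix d d′ eq₁
  ... | eq₂ , eq₃ with Dyck-irrelevant′ d d′ eq₂ | Dyck-irrelevant′ e e′ eq₃
  ... | refl | refl = refl

  module _ (_≟_ : DecidableEquality S) where

    ≟-Paren : DecidableEquality (Paren S)
    ≟-Paren (left α)  (left β)  = map′ (cong left) (λ { refl → refl }) (α ≟ β)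
    ≟-Paren (left α)  (right β) = no λ ()
    ≟-Paren (right α) (left β)  = no λ ()
    ≟-Paren (right α) (right β) = map′ (cong right) (λ { refl → refl }) (α ≟ β)

    ≟-DyckWord : DecidableEquality (DyckWord S)
    ≟-DyckWord (mkDyckWord {w} d) (mkDyckWord {w′} d′) =
      map′ (Dyck-irrelevant′ d d′) (cong DyckWord.word) (List.≡-dec ≟-Paren w w′)

data Tree (S : Set s) : Set s where
  node : List (S × Tree S) → Tree S

∣E∣ : {S : Set s} → Tree S → ℕ
∣E∣-forest : {S : Set s} → List (S × Tree S) → ℕ

∣E∣ (node ts) = ∣E∣-forest ts
∣E∣-forest []             = 0
∣E∣-forest ((_ , t) ∷ ts) = suc (∣E∣ t) ℕ.+ ∣E∣-forest ts

module _ {S : Set s} where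

  data Vertex : Tree S → Set s where
    root  : ∀ {t} → Vertex t
    below : ∀ {ts} (i : Fin (length ts)) → Vertex (proj₂ (lookup ts i)) → Vertex (node ts)

  data Edge : Tree S → Set s where
    top   : ∀ {ts} (i : Fin (length ts)) → Edge (node ts)
    below : ∀ {ts} (i : Fin (length ts)) → Edge (proj₂ (lookup ts i)) → Edge (node ts)

  parent child : ∀ {t} → Edge t → Vertex t
  parent (top i)     = root
  parent (below i e) = below i (parent e)
  child (top i)     = below i root
  child (below i e) = below i (child e)

  label : ∀ {t} → Edge t → S
  label (top {ts} i) = proj₁ (lookup ts i)
  label (below i e)  = label e

  forestOf : ∀ {w} → Dyck {S = S} w → List (S × Tree S)
  forestOf empty            = []
  forestOf (nest α d e) = (α , node (forestOf d)) ∷ forestOf e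

  T : DyckWord S → Tree S
  T w = node (forestOf (DyckWord.isDyck w))

  vertices : ∀ t → List (Vertex t)
  verticesBelow : ∀ ts (i : Fin (length ts)) → List (Vertex (proj₂ (lookup ts i)))

  vertices (node ts) = root ∷ concatMap (λ i → map (below i) (verticesBelow ts i)) (allFin _)
  verticesBelow ((_ , t) ∷ ts) zero    = vertices t
  verticesBelow (_ ∷ ts)       (suc i) = verticesBelow ts i

  ∈-vertices : ∀ {t} (v : Vertex t) → v ∈ vertices t
  ∈-verticesBelow : ∀ ts i (v : Vertex (proj₂ (lookup ts i))) → v ∈ vertices (proj₂ (lookup ts i)) →
                    v ∈ verticesBelow ts i

  ∈-vertices {node ts} root        = here refl
  ∈-vertices {node ts} (below i v) = there (∈-concatMap⁺ (λ i → map (below i) (verticesBelow ts i))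
    (Any.map (λ { refl → ∈-map⁺ (below i) (∈-verticesBelow ts i v (∈-vertices v)) }) (∈-allFin i)))
  ∈-verticesBelow (_ ∷ ts) zero    v v∈ = v∈
  ∈-verticesBelow (_ ∷ ts) (suc i) v v∈ = ∈-verticesBelow ts i v v∈

  edges : ∀ t → List (Edge t)
  edgesBelow : ∀ ts (i : Fin (length ts)) → List (Edge (proj₂ (lookup ts i)))

  edges (node ts) = concatMap (λ i → top i ∷ map (below i) (edgesBelow ts i)) (allFin _)
  edgesBelow ((_ , t) ∷ ts) zero    = edges t
  edgesBelow (_ ∷ ts)       (suc i) = edgesBelow ts i

  ∈-edges : ∀ {t} (e : Edge t) → e ∈ edges t
  ∈-edgesBelow : ∀ ts i (e : Edge (proj₂ (lookup ts i))) → e ∈ edges (proj₂ (lookup ts i)) →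
                 e ∈ edgesBelow ts i

  ∈-edges {node ts} (top i)     = ∈-concatMap⁺ (λ i → top i ∷ map (below i) (edgesBelow ts i))
    (Any.map (λ { refl → here refl }) (∈-allFin i))
  ∈-edges {node ts} (below i e) = ∈-concatMap⁺ (λ i → top i ∷ map (below i) (edgesBelow ts i))
    (Any.map (λ { refl → there (∈-map⁺ (below i) (∈-edgesBelow ts i e (∈-edges e))) }) (∈-allFin i))
  ∈-edgesBelow (_ ∷ ts) zero    e e∈ = e∈
  ∈-edgesBelow (_ ∷ ts) (suc i) e e∈ = ∈-edgesBelow ts i e e∈

module _ {S : Set s} (_≟_ : DecidableEquality S) (letters : List S) (∈-letters : ∀ α → α ∈ letters) where

  dyckWordsUpTo : ℕ → List (DyckWord S)
  dyckWordsUpTo zero    = mkDyckWord empty ∷ []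
  dyckWordsUpTo (suc n) = mkDyckWord empty ∷ cartesianProductWith
    (λ α dₑ → mkDyckWord (nest α (DyckWord.isDyck (proj₁ dₑ)) (DyckWord.isDyck (proj₂ dₑ))))
    letters (cartesianProductWith _,_ (dyckWordsUpTo n) (dyckWordsUpTo n))

  ∈-dyckWordsUpTo : ∀ {w} (d : Dyck w) n → ∣E∣ (T (mkDyckWord d)) ≤ n → mkDyckWord d ∈ dyckWordsUpTo n
  ∈-dyckWordsUpTo empty            zero    _       = here refl
  ∈-dyckWordsUpTo empty            (suc n) _       = here refl
  ∈-dyckWordsUpTo (nest α d e) (suc n) (s≤s ≤n) = there (∈-cartesianProductWith⁺
    (λ α dₑ → mkDyckWord (nest α (DyckWord.isDyck (proj₁ dₑ)) (DyckWord.isDyck (proj₂ dₑ))))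
    (∈-letters α)
    (∈-cartesianProductWith⁺ _,_
      (∈-dyckWordsUpTo d n (ℕ.m+n≤o⇒m≤o _ ≤n))
      (∈-dyckWordsUpTo e n (ℕ.m+n≤o⇒n≤o (∣E∣ (T (mkDyckWord d))) ≤n))))

  dyckWords : ∀ n → Enumeration (λ w → ∣E∣ (T w) ≡ n)
  dyckWords n = enumerate (≟-DyckWord _≟_) (λ w → ∣E∣ (T w) ℕ.≟ n) (dyckWordsUpTo n)
    λ { {mkDyckWord d} refl → ∈-dyckWordsUpTo d _ ℕ.≤-refl }

-- `elem` may repeat elements: only finiteness up to _≈_ is recorded.

record FiniteCover (A : Setoid a ℓ) : Set (a ⊔ ℓ) where
  open Setoid A
  field
    size       : ℕ
    elem       : Fin size → Carrier
    index      : Carrier → Fin size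
    elem-index : ∀ x → elem (index x) ≈ x
    _≟_        : B.Decidable _≈_

module _ (G : AbelianGroup a ℓ) where
  open AbelianGroup G
  open RawMonoidDefinitions rawMonoid using () renaming (_×_ to _×ℕ_; sum to ⨁)

  infixr 8 _·_

  _·_ : ℤ → Carrier → Carrier
  (+ n)    · x = n ×ℕ x
  -[1+ n ] · x = (suc n ×ℕ x) ⁻¹

  Generates : ∀ {k} → (Fin k → Carrier) → Set (a ⊔ ℓ)
  Generates {k} g = ∀ x → ∃ λ (z : Fin k → ℤ) → ⨁ (λ i → z i · g i) ≈ x

  -- Generating k-tuples may repeat entries; the least k is unaffected.

  GeneratedBy : ℕ → Set (a ⊔ ℓ)
  GeneratedBy k = ∃ λ (g : Fin k → Carrier) → Generates g

  IsRank : ℕ → Set (a ⊔ ℓ)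
  IsRank k = GeneratedBy k × (∀ j → GeneratedBy j → k ≤ j)

least : {P : ℕ → Set p} → Decidable P → ∀ {n} → P n → ∃ λ k → P k × (∀ j → P j → k ≤ j)
least P? {zero}  Pn = zero , Pn , λ _ _ → z≤n
least {P = P} P? {suc n} Pn with P? zero
... | yes P0 = zero , P0 , λ _ _ → z≤n
... | no ¬P0 with least {P = P ∘ suc} (P? ∘ suc) {n} Pn
...   | k , Pk , k≤ = suc k , Pk , λ { zero P0 → ⊥-elim (¬P0 P0) ; (suc j) Pj → s≤s (k≤ j Pj) }

module RankExists (G : AbelianGroup a ℓ) (F : FiniteCover (AbelianGroup.setoid G)) where
  open AbelianGroup G renaming (refl to ≈-refl; sym to ≈-sym; trans to ≈-trans)
  open AbelianGroupProperties G
  open CommutativeMonoidMult commutativeMonoid using (×-congʳ; ×-homo-+; ×-assocˡ) renaming (_×_ to _×ℕ_)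
  open CommutativeMonoidSum commutativeMonoid using (sum-cong-≋; sum-replicate-zero) renaming (sum to ⨁)
  open FiniteCover F
  open SetoidReasoning setoid

  ·-cong : ∀ z {x y} → x ≈ y → _·_ G z x ≈ _·_ G z y
  ·-cong (+ n)    x≈y = ×-congʳ n x≈y
  ·-cong -[1+ n ] x≈y = ⁻¹-cong (×-congʳ (suc n) x≈y)

  ×-ε : ∀ n → n ×ℕ ε ≈ ε
  ×-ε zero    = ≈-refl
  ×-ε (suc n) = ≈-trans (identityˡ _) (×-ε n)

  torsion : ∀ x → ∃ λ d → d ℕ.< size × suc d ×ℕ x ≈ ε
  torsion x with Fin.pigeonhole (ℕ.n<1+n size) (λ i → index (toℕ i ×ℕ x))
  ... | i , j , i<j , eq = ℕ.pred d , pred<size , ≡.subst (λ n → n ×ℕ x ≈ ε) (≡.sym suc-pred) d×x≈ε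
    where
    d = toℕ j ℕ.∸ toℕ i
    d+i≡j : d ℕ.+ toℕ i ≡ toℕ j
    d+i≡j = ℕ.m∸n+n≡m (ℕ.<⇒≤ i<j)
    suc-pred : suc (ℕ.pred d) ≡ d
    suc-pred = ℕ.suc-pred d {{ℕ.>-nonZero (ℕ.m<n⇒0<n∸m i<j)}}
    pred<size : ℕ.pred d ℕ.< size
    pred<size = ≡.subst (ℕ._≤ size) (≡.sym suc-pred)
      (ℕ.≤-trans (ℕ.m∸n≤m (toℕ j) (toℕ i)) (ℕ.s≤s⁻¹ (Fin.toℕ<n j)))
    d×x≈ε : d ×ℕ x ≈ ε
    d×x≈ε = identityˡ-unique (d ×ℕ x) (toℕ i ×ℕ x) (begin
      d ×ℕ x ∙ toℕ i ×ℕ x                 ≈⟨ ×-homo-+ x d (toℕ i) ⟨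
      (d ℕ.+ toℕ i) ×ℕ x                  ≡⟨ cong (_×ℕ x) d+i≡j ⟩
      toℕ j ×ℕ x                          ≈⟨ elem-index _ ⟨
      elem (index (toℕ j ×ℕ x))           ≡⟨ cong elem eq ⟨
      elem (index (toℕ i ×ℕ x))           ≈⟨ elem-index _ ⟩
      toℕ i ×ℕ x                          ∎)

  reduce : ∀ z x → ∃ λ (r : Fin (suc size)) → toℕ r ×ℕ x ≈ _·_ G z x
  reduce z x with torsion x
  ... | d′ , d′<size , d×x≈ε = go z
    where
    d = suc d′
    mod : ∀ n → (n % d) ×ℕ x ≈ n ×ℕ x
    mod n = begin
      (n % d) ×ℕ x                              ≈⟨ identityʳ _ ⟨
      (n % d) ×ℕ x ∙ ε                          ≈⟨ ∙-congˡ (×-ε (n / d)) ⟨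
      (n % d) ×ℕ x ∙ (n / d) ×ℕ ε               ≈⟨ ∙-congˡ (×-congʳ (n / d) d×x≈ε) ⟨
      (n % d) ×ℕ x ∙ (n / d) ×ℕ (d ×ℕ x)        ≈⟨ ∙-congˡ (×-assocˡ x (n / d) d) ⟩
      (n % d) ×ℕ x ∙ (n / d ℕ.* d) ×ℕ x         ≈⟨ ×-homo-+ x (n % d) (n / d ℕ.* d) ⟨
      (n % d ℕ.+ n / d ℕ.* d) ×ℕ x              ≡⟨ cong (_×ℕ x) (m≡m%n+[m/n]*n n d) ⟨
      n ×ℕ x                                    ∎
    fromSmall : ∀ {y} n → n ≤ d → n ×ℕ x ≈ y → ∃ λ (r : Fin (suc size)) → toℕ r ×ℕ x ≈ y
    fromSmall n n≤d eq = fromℕ< n<s , ≈-trans (reflexive (cong (_×ℕ x) (Fin.toℕ-fromℕ< n<s))) eq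
      where n<s = s≤s (ℕ.≤-trans n≤d d′<size)
    go : ∀ z → ∃ λ (r : Fin (suc size)) → toℕ r ×ℕ x ≈ _·_ G z x
    go (+ n)    = fromSmall (n % d) (ℕ.<⇒≤ (m%n<n n d)) (mod n)
    go -[1+ n ] = fromSmall (d ℕ.∸ r) (ℕ.m∸n≤m d r) (inverseˡ-unique _ _ (begin
      (d ℕ.∸ r) ×ℕ x ∙ suc n ×ℕ x      ≈⟨ ∙-congˡ (mod (suc n)) ⟨
      (d ℕ.∸ r) ×ℕ x ∙ r ×ℕ x          ≈⟨ ×-homo-+ x (d ℕ.∸ r) r ⟨
      (d ℕ.∸ r ℕ.+ r) ×ℕ x             ≡⟨ cong (_×ℕ x) (ℕ.m∸n+n≡m (ℕ.<⇒≤ (m%n<n (suc n) d))) ⟩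
      d ×ℕ x                           ≈⟨ d×x≈ε ⟩
      ε                                ∎))
      where r = suc n % d

  spans? : ∀ {k} (g : Fin k → Carrier) x → Dec (∃ λ (z : Fin k → ℤ) → ⨁ (λ i → _·_ G (z i) (g i)) ≈ x)
  spans? {k} g x = map′
    (λ (j , eq) → (λ i → + toℕ (finToFun {suc size} {k} j i)) , eq)
    (λ (z , eq) →
      let r = λ i → proj₁ (reduce (z i) (g i)) in
      funToFin r , ≈-trans (sum-cong-≋ λ i → ≈-trans
        (reflexive (cong (λ t → toℕ t ×ℕ g i) (Fin.finToFun-funToFin r i)))
        (proj₂ (reduce (z i) (g i)))) eq)
    (Fin.any? λ j → ⨁ (λ i → toℕ (finToFun {suc size} {k} j i) ×ℕ g i) ≟ x)

  generates? : ∀ {k} (g : Fin k → Carrier) → Dec (Generates G g)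
  generates? g = map′
    (λ h x → proj₁ (h (index x)) , ≈-trans (proj₂ (h (index x))) (elem-index x))
    (λ h i → h (elem i))
    (Fin.all? λ i → spans? g (elem i))

  Generates-resp : ∀ {k} {g h : Fin k → Carrier} → (∀ i → g i ≈ h i) → Generates G g → Generates G h
  Generates-resp g≈h gen x with gen x
  ... | z , eq = z , ≈-trans (sum-cong-≋ λ i → ·-cong (z i) (≈-sym (g≈h i))) eq

  generatedBy? : Decidable (GeneratedBy G)
  generatedBy? k = map′
    (λ (j , gen) → elem ∘ finToFun j , gen)
    (λ (g , gen) → funToFin (index ∘ g) , Generates-resp
      (λ i → ≈-sym (≈-trans (reflexive (cong elem (Fin.finToFun-funToFin (index ∘ g) i))) (elem-index (g i))))
      gen)
    (Fin.any? λ (j : Fin (size ℕ.^ k)) → generates? (elem ∘ finToFun j))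

  single : ∀ {k} (g : Fin k → Carrier) i → ∃ λ (z : Fin k → ℤ) → ⨁ (λ j → _·_ G (z j) (g j)) ≈ g i
  single {suc k} g zero = (λ { zero → + 1 ; (suc _) → + 0 }) , (begin
    (g zero ∙ ε) ∙ ⨁ {k} (λ _ → ε)  ≈⟨ ∙-cong (identityʳ _) (sum-replicate-zero k) ⟩
    g zero ∙ ε                      ≈⟨ identityʳ _ ⟩
    g zero                          ∎)
  single g (suc i) = let z , eq = single (g ∘ suc) i in
    (λ { zero → + 0 ; (suc j) → z j }) , ≈-trans (identityˡ _) eq

  rankExists : ∃ (IsRank G)
  rankExists = least generatedBy? {size}
    (elem , λ x → let z , eq = single elem (index x) in z , ≈-trans eq (elem-index x))

rankℤ : {R : CommutativeRing c ℓ} (M : Module R m ℓm) →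
        FiniteCover (AbelianGroup.setoid (Module.+ᴹ-abelianGroup M)) → ℕ
rankℤ M F = proj₁ (RankExists.rankExists (Module.+ᴹ-abelianGroup M) F)

HasOrder : CommutativeRing c ℓ → ℕ → Set (c ⊔ ℓ)
HasOrder R N = Inverse (CommutativeRing.setoid R) (≡.setoid (Fin N))

module FiniteRing (R : CommutativeRing c ℓ) {N : ℕ} (finite : HasOrder R N) where
  open CommutativeRing R renaming (refl to ≈-refl; sym to ≈-sym; trans to ≈-trans)
  open Inverse finite using (to; from; to-cong; strictlyInverseʳ)
  open RingProperties ring
    using (-‿+-comm; -‿distribʳ-*; -1*x≈-x)

  record IsIdeal (I : Pred Carrier p) : Set (c ⊔ p) where
    field
      0∈       : I 0#
      +-closed : ∀ {x y} → I x → I y → I (x + y)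
      *-closed : ∀ r {x} → I x → I (r * x)

  infix 4 _∈ᴿ_

  _∈ᴿ_ : Carrier → Subset N → Set
  x ∈ᴿ I = to x ∈ˢ I

  -- Classically every subset of R closed under _≈_ has the form (_∈ᴿ I).
  -- Irrelevance of `isIdeal` makes _≡_ on ideals coincide with equality of the
  -- underlying subsets.

  record Ideal : Set c where
    constructor mkIdeal
    field
      subset   : Subset N
      .isIdeal : IsIdeal (_∈ᴿ subset)

  ∈ᴿ-resp : ∀ I {x y} → x ≈ y → x ∈ᴿ I → y ∈ᴿ I
  ∈ᴿ-resp I x≈y = subst (_∈ˢ I) (to-cong x≈y)

  all? : {P : Pred Carrier p} → (∀ {x y} → x ≈ y → P x → P y) → Decidable P → Dec (∀ x → P x)
  all? resp P? = map′ (λ h x → resp (strictlyInverseʳ x) (h (to x))) (λ h i → h (from i)) (Fin.all? (P? ∘ from))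

  isIdeal? : ∀ I → Dec (IsIdeal (_∈ᴿ I))
  isIdeal? I = map′
    (λ (z , pl , ti) → record { 0∈ = z ; +-closed = λ {x} {y} → pl x y ; *-closed = λ r {x} → ti r x })
    (λ i → let open IsIdeal i in 0∈ , (λ x y → +-closed) , λ r x → *-closed r)
    ((to 0# ∈ˢ? I)
      ×-dec all? (λ eq h y y∈ x∈ → ∈ᴿ-resp I (+-congʳ eq) (h y (∈ᴿ-resp I (≈-sym eq) y∈) x∈))
                 (λ x → all? (λ eq h x∈ y∈ → ∈ᴿ-resp I (+-congˡ eq) (h x∈ (∈ᴿ-resp I (≈-sym eq) y∈)))
                             (λ y → (to x ∈ˢ? I) →-dec ((to y ∈ˢ? I) →-dec (to (x + y) ∈ˢ? I))))
      ×-dec all? (λ eq h x x∈ → ∈ᴿ-resp I (*-congʳ eq) (h x x∈))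
                 (λ r → all? (λ eq h x∈ → ∈ᴿ-resp I (*-congˡ eq) (h (∈ᴿ-resp I (≈-sym eq) x∈)))
                             (λ x → (to x ∈ˢ? I) →-dec (to (r * x) ∈ˢ? I))))

  ideal-isIdeal : (I : Ideal) → IsIdeal (_∈ᴿ Ideal.subset I)
  ideal-isIdeal (mkIdeal I isI) = recompute (isIdeal? I) isI

  _≟ᴵ_ : DecidableEquality Ideal
  mkIdeal I _ ≟ᴵ mkIdeal J _ = map′ (λ { refl → refl }) (cong Ideal.subset) (Vec.≡-dec _≟ᵇ_ I J)

  subsets : ∀ n → List (Subset n)
  subsets zero    = [] ∷ []
  subsets (suc n) = cartesianProductWith _∷_ (outside ∷ inside ∷ []) (subsets n)

  ∈-subsets : ∀ {n} (I : Subset n) → I ∈ subsets n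
  ∈-subsets []            = here refl
  ∈-subsets (outside ∷ I) = ∈-cartesianProductWith⁺ _∷_ {xs = outside ∷ inside ∷ []} (here refl) (∈-subsets I)
  ∈-subsets (inside ∷ I)  = ∈-cartesianProductWith⁺ _∷_ {xs = outside ∷ inside ∷ []} (there (here refl)) (∈-subsets I)

  idealsAmong : List (Subset N) → List Ideal
  idealsAmong []       = []
  idealsAmong (I ∷ Is) with isIdeal? I
  ... | yes isI = mkIdeal I isI ∷ idealsAmong Is
  ... | no _    = idealsAmong Is

  ∈-idealsAmong : ∀ {Is} (I : Ideal) → Ideal.subset I ∈ Is → I ∈ idealsAmong Is
  ∈-idealsAmong {J ∷ Is} I I∈ with isIdeal? J
  ∈-idealsAmong {J ∷ Is} I (here refl) | yes _  = here refl
  ∈-idealsAmong {J ∷ Is} I (there I∈)  | yes _  = there (∈-idealsAmong I I∈)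
  ∈-idealsAmong {J ∷ Is} I (here refl) | no ¬isI = ⊥-elim (¬isI (ideal-isIdeal I))
  ∈-idealsAmong {J ∷ Is} I (there I∈)  | no _   = ∈-idealsAmong I I∈

  ideals : List Ideal
  ideals = idealsAmong (subsets N)

  ∈-ideals : ∀ I → I ∈ ideals
  ∈-ideals I = ∈-idealsAmong I (∈-subsets (Ideal.subset I))

  module _ (t : Tree Ideal) where

    -- One orientation of each edge suffices: ideals are closed under negation.

    IsSpline : (Vertex t → Carrier) → Set c
    IsSpline f = ∀ (e : Edge t) → f (parent e) - f (child e) ∈ᴿ Ideal.subset (label e)

    record Spline : Set c where
      constructor mkSpline
      field
        value    : Vertex t → Carrier
        isSpline : IsSpline value

    open Spline

    IsSpline-resp : ∀ {f g} → (∀ v → f v ≈ g v) → IsSpline f → IsSpline g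
    IsSpline-resp f≈g f∈ e = ∈ᴿ-resp (Ideal.subset (label e)) (+-cong (f≈g _) (-‿cong (f≈g _))) (f∈ e)

    Spl : Module R c (c ⊔ ℓ)
    Spl = record
      { Carrierᴹ = Spline
      ; _≈ᴹ_     = λ f g → ∀ v → value f v ≈ value g v
      ; _+ᴹ_     = λ f g → mkSpline (λ v → value f v + value g v) (+-spline f g)
      ; _*ₗ_     = λ r f → mkSpline (λ v → r * value f v) (*-spline r f)
      ; _*ᵣ_     = λ f r → mkSpline (λ v → value f v * r)
                             (IsSpline-resp (λ v → *-comm r (value f v)) (*-spline r f))
      ; 0ᴹ       = mkSpline (λ _ → 0#) 0-spline
      ; -ᴹ_      = λ f → mkSpline (λ v → - value f v)
                             (IsSpline-resp (λ v → -1*x≈-x (value f v)) (*-spline (- 1#) f))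
      ; isModule = record
        { isBimodule = record
          { isBisemimodule = record
            { +ᴹ-isCommutativeMonoid = record
              { isMonoid = record
                { isSemigroup = record
                  { isMagma = record
                    { isEquivalence = record
                      { refl  = λ _ → ≈-refl
                      ; sym   = λ eq v → ≈-sym (eq v)
                      ; trans = λ eq eq′ v → ≈-trans (eq v) (eq′ v)
                      }
                    ; ∙-cong = λ eq eq′ v → +-cong (eq v) (eq′ v)
                    }
                  ; assoc = λ _ _ _ _ → +-assoc _ _ _
                  }
                ; identity = (λ _ _ → +-identityˡ _) , λ _ _ → +-identityʳ _
                }
              ; comm = λ _ _ _ → +-comm _ _
              }
            ; isPreleftSemimodule = record
              { *ₗ-cong      = λ eq eq′ v → *-cong eq (eq′ v)
              ; *ₗ-zeroˡ     = λ _ _ → zeroˡ _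
              ; *ₗ-distribʳ  = λ _ _ _ _ → distribʳ _ _ _
              ; *ₗ-identityˡ = λ _ _ → *-identityˡ _
              ; *ₗ-assoc     = λ _ _ _ _ → *-assoc _ _ _
              ; *ₗ-zeroʳ     = λ _ _ → zeroʳ _
              ; *ₗ-distribˡ  = λ _ _ _ _ → distribˡ _ _ _
              }
            ; isPrerightSemimodule = record
              { *ᵣ-cong      = λ eq eq′ v → *-cong (eq v) eq′
              ; *ᵣ-zeroʳ     = λ _ _ → zeroʳ _
              ; *ᵣ-distribˡ  = λ _ _ _ _ → distribˡ _ _ _
              ; *ᵣ-identityʳ = λ _ _ → *-identityʳ _
              ; *ᵣ-assoc     = λ _ _ _ _ → *-assoc _ _ _
              ; *ᵣ-zeroˡ     = λ _ _ → zeroˡ _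
              ; *ᵣ-distribʳ  = λ _ _ _ _ → distribʳ _ _ _
              }
            ; *ₗ-*ᵣ-assoc = λ _ _ _ _ → *-assoc _ _ _
            }
          ; -ᴹ‿cong    = λ eq v → -‿cong (eq v)
          ; -ᴹ‿inverse = (λ _ _ → -‿inverseˡ _) , λ _ _ → -‿inverseʳ _
          }
        ; *ₗ-*ᵣ-coincident = λ _ _ _ → *-comm _ _
        }
      }
      where
      open SetoidReasoning setoid
      module I (e : Edge t) = IsIdeal (ideal-isIdeal (label e))

      0-spline : IsSpline (λ _ → 0#)
      0-spline e = ∈ᴿ-resp (Ideal.subset (label e)) (≈-sym (-‿inverseʳ 0#)) (I.0∈ e)

      +-spline : ∀ f g → IsSpline (λ v → value f v + value g v)
      +-spline (mkSpline f f∈) (mkSpline g g∈) e =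
        ∈ᴿ-resp (Ideal.subset (label e)) eq (I.+-closed e (f∈ e) (g∈ e))
        where
        u = parent e
        v = child e
        eq : (f u - f v) + (g u - g v) ≈ (f u + g u) - (f v + g v)
        eq = begin
          (f u - f v) + (g u - g v)     ≈⟨ +-assoc _ _ _ ⟩
          f u + (- f v + (g u - g v))   ≈⟨ +-congˡ (+-assoc _ _ _) ⟨
          f u + ((- f v + g u) - g v)   ≈⟨ +-congˡ (+-congʳ (+-comm _ _)) ⟩
          f u + ((g u - f v) - g v)     ≈⟨ +-congˡ (+-assoc _ _ _) ⟩
          f u + (g u + (- f v - g v))   ≈⟨ +-assoc _ _ _ ⟨
          (f u + g u) + (- f v - g v)   ≈⟨ +-congˡ (-‿+-comm _ _) ⟩
          (f u + g u) - (f v + g v)     ∎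

      *-spline : ∀ r f → IsSpline (λ v → r * value f v)
      *-spline r (mkSpline f f∈) e = ∈ᴿ-resp (Ideal.subset (label e)) eq (I.*-closed e r (f∈ e))
        where
        eq : r * (f (parent e) - f (child e)) ≈ r * f (parent e) - r * f (child e)
        eq = ≈-trans (distribˡ _ _ _) (+-congˡ (≈-sym (-‿distribʳ-* _ _)))

    isSpline? : Decidable IsSpline
    isSpline? f = map′ (λ h e → All.lookup h (∈-edges e)) (λ h → All.tabulate (λ {e} _ → h e))
      (All.all? (λ e → to (f (parent e) - f (child e)) ∈ˢ? Ideal.subset (label e)) (edges t))

    Spl-finite : FiniteCover (AbelianGroup.setoid (Module.+ᴹ-abelianGroup Spl))
    Spl-finite = record
      { size       = N ℕ.^ length (vertices t)
      ; elem       = λ j → project (decode j)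
      ; index      = encode
      ; elem-index = λ p → project-decode p
      ; _≟_        = λ f g → map′ (λ h v → All.lookup h (∈-vertices v)) (λ h → All.tabulate (λ {v} _ → h v))
                       (All.all? (λ v → map′ to-injective to-cong (to (value f v) Fin.≟ to (value g v))) (vertices t))
      }
      where
      to-injective : ∀ {x y} → to x ≡ to y → x ≈ y
      to-injective {x} {y} eq = ≈-trans (≈-sym (strictlyInverseʳ x))
        (≈-trans (reflexive (cong from eq)) (strictlyInverseʳ y))

      decode : Fin (N ℕ.^ length (vertices t)) → Vertex t → Carrier
      decode j v = from (finToFun j (Any.index (∈-vertices v)))

      encode : Spline → Fin (N ℕ.^ length (vertices t))
      encode p = funToFin (λ i → to (value p (lookup (vertices t) i)))

      project : (Vertex t → Carrier) → Spline
      project f with isSpline? f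
      ... | yes f∈ = mkSpline f f∈
      ... | no _   = Module.0ᴹ Spl

      decode-encode : ∀ p v → decode (encode p) v ≈ value p v
      decode-encode p v = ≈-trans
        (reflexive (cong from (Fin.finToFun-funToFin (λ i → to (value p (lookup (vertices t) i))) _)))
        (≈-trans (strictlyInverseʳ _) (reflexive (cong (value p) (≡.sym (lookup-index (∈-vertices v))))))

      project-decode : ∀ p v → value (project (decode (encode p))) v ≈ value p v
      project-decode p v with isSpline? (decode (encode p))
      ... | yes _ = decode-encode p v
      ... | no ∉  = ⊥-elim (∉ (IsSpline-resp (λ v → ≈-sym (decode-encode p v)) (isSpline p)))

  rankSpl : Tree Ideal → ℕ
  rankSpl t = rankℤ (Spl t) (Spl-finite t)

PowerSeries : Set
PowerSeries = ℕ → ℚ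

infixl 6 _⊕_
infixl 7 _⊛_

_⊕_ _⊛_ : PowerSeries → PowerSeries → PowerSeries
(F ⊕ G) n = F n ℚ.+ G n
(F ⊛ G) n = ⨁ {suc n} (λ i → F (toℕ i) ℚ.* G (n ℕ.∸ toℕ i))
  where open RawMonoidDefinitions ℚ.+-0-rawMonoid using () renaming (sum to ⨁)

ℚ[t] : Set
ℚ[t] = List ℚ

toSeries : ℚ[t] → PowerSeries
toSeries []       n       = 0ℚ
toSeries (q ∷ qs) zero    = q
toSeries (q ∷ qs) (suc n) = toSeries qs n

-- Coefficient lists, lowest power of x (resp. t) first; trailing zeros are
-- allowed.

ℚ[t][x] : Set
ℚ[t][x] = List ℚ[t]

NonZeroPoly : ℚ[t][x] → Set
NonZeroPoly = Any (Any (_≢ 0ℚ))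

eval : ℚ[t][x] → PowerSeries → PowerSeries
eval []       F = λ _ → 0ℚ
eval (q ∷ qs) F = toSeries q ⊕ F ⊛ eval qs F

IsAlgebraic : PowerSeries → Set
IsAlgebraic F = ∃ λ P → NonZeroPoly P × (∀ n → eval P F n ≡ 0ℚ)

HD : (R : CommutativeRing c ℓ) {N : ℕ} → HasOrder R N → PowerSeries
HD R finite n = + ∑ (dyckWords _≟ᴵ_ ideals ∈-ideals n) (λ w → rankSpl (T w)) ℚ./ 1
  where open FiniteRing R finite

{-# OPTIONS --safe #-}
module Submission where

-- A spline on a tree is given by its value at the root and its differences along
-- the edges, and these are arbitrary: Spl(T) ≅ R ⊕ ⨁ₑ α(e) as abelian groups. The
-- rank of a finite abelian p-group M is the dimension of M / pM over the field with
-- p elements, hence additive, so rank Spl(T) = rank R + Σₑ rank α(e).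
--
-- Let s be the number of ideals, r = rank R and ρ the sum of the ranks of all
-- ideals. Decomposing words as (α u )α v, the series D counting words and the series
-- G adding up their edge ranks satisfy D = 1 + s t D² and G = ρ t D² + 2 s t D G, and
-- HD = r D + G lies in the quadratic extension of ℚ(t) generated by D.

open import Algebra.Bundles using (AbelianGroup; CommutativeMonoid; CommutativeRing)
open import Algebra.Module.Bundles using (Module)
open import Algebra.Morphism.Structures using (module MonoidMorphisms)
open import Algebra.Solver.Ring.AlmostCommutativeRing using (fromCommutativeRing; _-Raw-AlmostCommutative⟶_)
import Algebra.Construct.DirectProduct as DirectProduct
import Algebra.Definitions.RawMonoid as RawMonoidDefinitions
import Algebra.Properties.AbelianGroup as AbelianGroupProperties
import Algebra.Properties.CommutativeMonoid.Mult as CommutativeMonoidMult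
import Algebra.Properties.CommutativeMonoid.Sum as CommutativeMonoidSum
import Algebra.Properties.CommutativeSemigroup as CommutativeSemigroupProperties
import Algebra.Properties.Ring as RingProperties
import Algebra.Solver.Ring
open import Data.Fin.Base as Fin using (Fin; zero; suc; toℕ; fromℕ<; finToFun; funToFin; _↑ˡ_; _↑ʳ_; splitAt)
open import Data.Fin.Permutation using (permutation)
import Data.Fin.Properties as Fin
open import Data.Fin.Subset using (⊤) renaming (_∈_ to _∈ˢ_)
open import Data.Fin.Subset.Properties using (∈⊤) renaming (_∈?_ to _∈ˢ?_)
open import Data.Integer.Base as ℤ using (ℤ; +_; -[1+_])
import Data.Integer.Properties as ℤ
open import Data.List.Base
  using (List; []; _∷_; map; length; concatMap; cartesianProduct; cartesianProductWith; deduplicate; allFin; tabulate)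
import Data.List.Properties as List
open import Data.List.Membership.Propositional using (_∈_)
open import Data.List.Membership.Propositional.Properties
  using (∈-concatMap⁺; ∈-concatMap⁻; ∈-cartesianProductWith⁺; ∈-cartesianProductWith⁻
        ; ∈-cartesianProduct⁺; ∈-cartesianProduct⁻; ∈-deduplicate⁺; ∈-allFin)
open import Data.List.Membership.Propositional.Properties.WithK using (unique∧set⇒bag)
open import Data.List.Relation.Binary.BagAndSetEquality using (∼bag⇒↭)
open import Data.List.Relation.Binary.Permutation.Propositional.Properties using (map⁺)
open import Data.List.Relation.Unary.All as All using ([])
import Data.List.Relation.Unary.All.Properties as All
import Data.List.Relation.Unary.AllPairs as AllPairs
import Data.List.Relation.Unary.AllPairs.Properties as AllPairs
open import Data.List.Relation.Unary.Any as Any using (here; there; satisfied)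
open import Data.List.Relation.Unary.Unique.Propositional using (Unique)
import Data.List.Relation.Unary.Unique.Propositional.Properties as Unique
import Data.List.Relation.Unary.Unique.DecPropositional.Properties as DecUnique
open import Data.Maybe.Base using (Maybe; just; nothing)
open import Data.Nat.Base as ℕ using (ℕ; zero; suc; _≤_; _<_; _^_)
open import Data.Nat.Coprimality using (Coprime; coprime-Bézout)
open import Data.Nat.Divisibility using (_∣_; divides; _∣?_; m%n≡0⇒n∣m)
open import Data.Nat.DivMod using (_%_; m%n<n; %-distribˡ-+; m*n%n≡0; [m+kn]%n≡m%n; m<n⇒m%n≡m)
open import Data.Nat.GCD using (module Bézout)
open import Data.Nat.ListAction using (sum)
open import Data.Nat.ListAction.Properties using (sum-++; sum-↭)
open import Data.Nat.Primality using (Prime; prime⇒irreducible; prime⇒nonTrivial)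
import Data.Nat.Properties as ℕ
open import Data.Product.Base using (∃; ∃₂; _×_; _,_; proj₁; proj₂)
open import Data.Rational.Base as ℚ using (ℚ; 0ℚ; 1ℚ)
import Data.Rational.Properties as ℚ
import Data.Rational.Unnormalised.Base as ℚᵘ
import Data.Rational.Unnormalised.Properties as ℚᵘ
open import Data.Sum.Base using ([_,_]; inj₁; inj₂)
open import Data.Sum.Properties using ([,]-∘)
open import Data.Vec.Functional using (removeAt)
open import Function.Base using (_∘_)
open import Function.Bundles using (Inverse; mk⇔)
open import Level using (Level; 0ℓ; _⊔_)
open import Relation.Binary.PropositionalEquality as ≡ using (_≡_; _≢_; _≗_; refl; cong; cong₂)
import Relation.Binary.Reasoning.Setoid as SetoidReasoning
open import Relation.Nullary using (contradiction; yes; no; ¬_)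
open import Relation.Nullary.Decidable using (map′)
open import Relation.Unary using (Pred)
open import Defs

-- Ranks of finite abelian groups need not add up: ℤ/2 and ℤ/3 both have rank 1, and so has their
-- product. That the order of `R` is a power of p excludes this through a single fact: a generating
-- family of least size in a finite abelian p-group is independent modulo p. The quotient M / pM is
-- never formed. `HasBasis` asks for spanning in M itself and for independence up to multiples of p,
-- which can be checked coordinatewise in a product, whereas minimality cannot. On the side of the
-- series, no inverse and no square root is taken. Multiplication by Q = 1 - 2 s t D turns an affine
-- expression in HD into a polynomial in t alone, and only Q², which is free of D, enters the final
-- equation. That equation is not trivial: its coefficient at x² t² is 4 s⁴, and s is positive
-- because R is an ideal of itself.

private
  variable
    a b c ℓ ℓ′ : Level
    A B C : Set a

-- Natural numbers inside the rationals

ℕ⇒ℚ : ℕ → ℚ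
ℕ⇒ℚ n = + n ℚ./ 1

2ℚ 4ℚ : ℚ
2ℚ = ℕ⇒ℚ 2
4ℚ = ℕ⇒ℚ 4

-- The fraction in `ℕ⇒ℚ` is normalised, which blocks reduction for a variable numerator; the two
-- sides are therefore compared as unnormalised fractions.
ℕ⇒ℚ-homo-+ : ∀ m n → ℕ⇒ℚ (m ℕ.+ n) ≡ ℕ⇒ℚ m ℚ.+ ℕ⇒ℚ n
ℕ⇒ℚ-homo-+ m n = ℚ.toℚᵘ-injective (begin
  ℚ.toℚᵘ (ℕ⇒ℚ (m ℕ.+ n))                    ≈⟨ ℚ.toℚᵘ-fromℚᵘ (+ (m ℕ.+ n) ℚᵘ./ 1) ⟩
  + (m ℕ.+ n) ℚᵘ./ 1                        ≈⟨ ℚᵘ.*≡* (cong (ℤ._* + 1) (≡.trans (ℤ.pos-+ m n)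
                                                   (cong₂ ℤ._+_ (≡.sym (ℤ.*-identityʳ (+ m))) (≡.sym (ℤ.*-identityʳ (+ n)))))) ⟩
  + m ℚᵘ./ 1 ℚᵘ.+ + n ℚᵘ./ 1                ≈⟨ ℚᵘ.+-cong (ℚ.toℚᵘ-fromℚᵘ (+ m ℚᵘ./ 1)) (ℚ.toℚᵘ-fromℚᵘ (+ n ℚᵘ./ 1)) ⟨
  ℚ.toℚᵘ (ℕ⇒ℚ m) ℚᵘ.+ ℚ.toℚᵘ (ℕ⇒ℚ n)        ≈⟨ ℚ.toℚᵘ-homo-+ (ℕ⇒ℚ m) (ℕ⇒ℚ n) ⟨
  ℚ.toℚᵘ (ℕ⇒ℚ m ℚ.+ ℕ⇒ℚ n)                  ∎)
  where open ℚᵘ.≃-Reasoning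

ℕ⇒ℚ-homo-* : ∀ m n → ℕ⇒ℚ (m ℕ.* n) ≡ ℕ⇒ℚ m ℚ.* ℕ⇒ℚ n
ℕ⇒ℚ-homo-* m n = ℚ.toℚᵘ-injective (begin
  ℚ.toℚᵘ (ℕ⇒ℚ (m ℕ.* n))                    ≈⟨ ℚ.toℚᵘ-fromℚᵘ (+ (m ℕ.* n) ℚᵘ./ 1) ⟩
  + (m ℕ.* n) ℚᵘ./ 1                        ≈⟨ ℚᵘ.*≡* (cong (ℤ._* + 1) (ℤ.pos-* m n)) ⟩
  (+ m ℚᵘ./ 1) ℚᵘ.* (+ n ℚᵘ./ 1)            ≈⟨ ℚᵘ.*-cong (ℚ.toℚᵘ-fromℚᵘ (+ m ℚᵘ./ 1)) (ℚ.toℚᵘ-fromℚᵘ (+ n ℚᵘ./ 1)) ⟨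
  ℚ.toℚᵘ (ℕ⇒ℚ m) ℚᵘ.* ℚ.toℚᵘ (ℕ⇒ℚ n)        ≈⟨ ℚ.toℚᵘ-homo-* (ℕ⇒ℚ m) (ℕ⇒ℚ n) ⟨
  ℚ.toℚᵘ (ℕ⇒ℚ m ℚ.* ℕ⇒ℚ n)                  ∎)
  where open ℚᵘ.≃-Reasoning

ℕ⇒ℚ-injective : ∀ {m n} → ℕ⇒ℚ m ≡ ℕ⇒ℚ n → m ≡ n
ℕ⇒ℚ-injective {m} {n} eq = ℤ.+-injective (ℤ.*-cancelʳ-≡ (+ m) (+ n) (+ 1)
  (ℚᵘ.drop-*≡* (ℚ.fromℚᵘ-injective {+ m ℚᵘ./ 1} {+ n ℚᵘ./ 1} eq)))

-- The ring of formal power series over ℚ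

module _ where
  open ≡.≡-Reasoning
  open CommutativeSemigroupProperties (CommutativeMonoid.commutativeSemigroup ℚ.+-0-commutativeMonoid)
    using (interchange; x∙yz≈y∙xz)

  ⊛-head : ∀ F G → (F ⊛ G) 0 ≡ F 0 ℚ.* G 0
  ⊛-head F G = ℚ.+-identityʳ (F 0 ℚ.* G 0)

  ⊛-cong : ∀ {F F′ G G′} → F ≗ F′ → G ≗ G′ → F ⊛ G ≗ F′ ⊛ G′
  ⊛-cong F≗ G≗ zero    = cong₂ ℚ._+_ (cong₂ ℚ._*_ (F≗ 0) (G≗ 0)) refl
  ⊛-cong F≗ G≗ (suc n) = cong₂ ℚ._+_ (cong₂ ℚ._*_ (F≗ 0) (G≗ (suc n))) (⊛-cong (F≗ ∘ suc) G≗ n)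

  ⊛-distribʳ : ∀ H F G → (F ⊕ G) ⊛ H ≗ (F ⊛ H) ⊕ (G ⊛ H)
  ⊛-distribʳ H F G zero    = ≡.trans (≡.trans (⊛-head (F ⊕ G) H) (ℚ.*-distribʳ-+ (H 0) (F 0) (G 0)))
    (≡.sym (cong₂ ℚ._+_ (⊛-head F H) (⊛-head G H)))
  ⊛-distribʳ H F G (suc n) = ≡.trans
    (cong₂ ℚ._+_ (ℚ.*-distribʳ-+ (H (suc n)) (F 0) (G 0)) (⊛-distribʳ H (F ∘ suc) (G ∘ suc) n))
    (interchange (F 0 ℚ.* H (suc n)) (G 0 ℚ.* H (suc n)) _ _)

  -- By reduction a product splits off its first summand; here the last one is split off. Matching
  -- the two recursions with the factors exchanged proves `⊛-comm`.
  ⊛-suc : ∀ F G n → (F ⊛ G) (suc n) ≡ F (suc n) ℚ.* G 0 ℚ.+ (F ⊛ (G ∘ suc)) n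
  ⊛-suc F G zero    = begin
    F 0 ℚ.* G 1 ℚ.+ (F 1 ℚ.* G 0 ℚ.+ 0ℚ)  ≡⟨ x∙yz≈y∙xz (F 0 ℚ.* G 1) (F 1 ℚ.* G 0) 0ℚ ⟩
    F 1 ℚ.* G 0 ℚ.+ (F 0 ℚ.* G 1 ℚ.+ 0ℚ)  ∎
  ⊛-suc F G (suc n) = ≡.trans (cong (F 0 ℚ.* G (suc (suc n)) ℚ.+_) (⊛-suc (F ∘ suc) G n))
    (x∙yz≈y∙xz (F 0 ℚ.* G (suc (suc n))) (F (suc (suc n)) ℚ.* G 0) _)

  ⊛-comm : ∀ F G → F ⊛ G ≗ G ⊛ F
  ⊛-comm F G zero    = cong (ℚ._+ 0ℚ) (ℚ.*-comm (F 0) (G 0))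
  ⊛-comm F G (suc n) = ≡.trans (⊛-suc F G n)
    (cong₂ ℚ._+_ (ℚ.*-comm (F (suc n)) (G 0)) (⊛-comm F (G ∘ suc) n))

  infixr 8 _•_

  _•_ : ℚ → PowerSeries → PowerSeries
  (q • F) n = q ℚ.* F n

  •-⊛ : ∀ q F G → (q • F) ⊛ G ≗ q • (F ⊛ G)
  •-⊛ q F G zero    = ≡.trans (⊛-head (q • F) G)
    (≡.trans (ℚ.*-assoc q (F 0) (G 0)) (cong (q ℚ.*_) (≡.sym (⊛-head F G))))
  •-⊛ q F G (suc n) = ≡.trans (cong₂ ℚ._+_ (ℚ.*-assoc q (F 0) (G (suc n))) (•-⊛ q (F ∘ suc) G n))
    (≡.sym (ℚ.*-distribˡ-+ q _ _))

  ⊛-assoc : ∀ F G H → (F ⊛ G) ⊛ H ≗ F ⊛ (G ⊛ H)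
  ⊛-assoc F G H zero    = cong (ℚ._+ 0ℚ) (≡.trans (cong (ℚ._* H 0) (⊛-head F G))
    (≡.trans (ℚ.*-assoc (F 0) (G 0) (H 0)) (cong (F 0 ℚ.*_) (≡.sym (⊛-head G H)))))
  ⊛-assoc F G H (suc n) = begin
    -- By reduction, the shift of `F ⊛ G` is `F 0 • (G ∘ suc) ⊕ (F ∘ suc) ⊛ G`, to which
    -- distributivity and the induction hypothesis apply.
    (F ⊛ G) 0 ℚ.* H (suc n) ℚ.+ ((F 0 • (G ∘ suc) ⊕ (F ∘ suc) ⊛ G) ⊛ H) n
      ≡⟨ cong₂ ℚ._+_
           (≡.trans (cong (ℚ._* H (suc n)) (⊛-head F G)) (ℚ.*-assoc (F 0) (G 0) (H (suc n))))
           (≡.trans (⊛-distribʳ H (F 0 • (G ∘ suc)) ((F ∘ suc) ⊛ G) n)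
             (cong₂ ℚ._+_ (•-⊛ (F 0) (G ∘ suc) H n) (⊛-assoc (F ∘ suc) G H n))) ⟩
    F 0 ℚ.* (G 0 ℚ.* H (suc n)) ℚ.+ (F 0 ℚ.* ((G ∘ suc) ⊛ H) n ℚ.+ ((F ∘ suc) ⊛ (G ⊛ H)) n)
      ≡⟨ ℚ.+-assoc (F 0 ℚ.* (G 0 ℚ.* H (suc n))) (F 0 ℚ.* ((G ∘ suc) ⊛ H) n) _ ⟨
    F 0 ℚ.* (G 0 ℚ.* H (suc n)) ℚ.+ F 0 ℚ.* ((G ∘ suc) ⊛ H) n ℚ.+ ((F ∘ suc) ⊛ (G ⊛ H)) n
      ≡⟨ cong (ℚ._+ ((F ∘ suc) ⊛ (G ⊛ H)) n) (ℚ.*-distribˡ-+ (F 0) (G 0 ℚ.* H (suc n)) _) ⟨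
    F 0 ℚ.* (G ⊛ H) (suc n) ℚ.+ ((F ∘ suc) ⊛ (G ⊛ H)) n  ∎

  constant : ℚ → PowerSeries
  constant q zero    = q
  constant q (suc n) = 0ℚ

  ⊛-zeroˡ : ∀ F → (λ _ → 0ℚ) ⊛ F ≗ λ _ → 0ℚ
  ⊛-zeroˡ F zero    = ≡.trans (ℚ.+-identityʳ _) (ℚ.*-zeroˡ (F 0))
  ⊛-zeroˡ F (suc n) = cong₂ ℚ._+_ (ℚ.*-zeroˡ (F (suc n))) (⊛-zeroˡ F n)

  constant-⊛ : ∀ q F → constant q ⊛ F ≗ q • F
  constant-⊛ q F zero    = ℚ.+-identityʳ _
  constant-⊛ q F (suc n) = ≡.trans (cong (q ℚ.* F (suc n) ℚ.+_) (⊛-zeroˡ F n)) (ℚ.+-identityʳ _)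

  ⊛-identityˡ : ∀ F → constant 1ℚ ⊛ F ≗ F
  ⊛-identityˡ F n = ≡.trans (constant-⊛ 1ℚ F n) (ℚ.*-identityˡ (F n))

powerSeriesRing : CommutativeRing 0ℓ 0ℓ
powerSeriesRing = record
  { Carrier = PowerSeries
  ; _≈_ = _≗_
  ; _+_ = _⊕_
  ; _*_ = _⊛_
  ; -_ = λ F n → ℚ.- F n
  ; 0# = λ _ → 0ℚ
  ; 1# = constant 1ℚ
  ; isCommutativeRing = record
    { isRing = record
      { +-isAbelianGroup = record
        { isGroup = record
          { isMonoid = record
            { isSemigroup = record
              { isMagma = record
                { isEquivalence = record
                  { refl  = λ _ → refl
                  ; sym   = λ eq n → ≡.sym (eq n)
                  ; trans = λ eq eq′ n → ≡.trans (eq n) (eq′ n)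
                  }
                ; ∙-cong = λ eq eq′ n → cong₂ ℚ._+_ (eq n) (eq′ n)
                }
              ; assoc = λ F G H n → ℚ.+-assoc (F n) (G n) (H n)
              }
            ; identity = (λ F n → ℚ.+-identityˡ (F n)) , λ F n → ℚ.+-identityʳ (F n)
            }
          ; inverse = (λ F n → ℚ.+-inverseˡ (F n)) , λ F n → ℚ.+-inverseʳ (F n)
          ; ⁻¹-cong = λ eq n → cong ℚ.-_ (eq n)
          }
        ; comm = λ F G n → ℚ.+-comm (F n) (G n)
        }
      ; *-cong = ⊛-cong
      ; *-assoc = ⊛-assoc
      ; *-identity = ⊛-identityˡ , λ F n → ≡.trans (⊛-comm F (constant 1ℚ) n) (⊛-identityˡ F n)
      ; distrib = (λ F G H n → ≡.trans (⊛-comm F (G ⊕ H) n) (≡.trans (⊛-distribʳ F G H n)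
                     (cong₂ ℚ._+_ (⊛-comm G F n) (⊛-comm H F n))))
                , ⊛-distribʳ
      }
    ; *-comm = ⊛-comm
    }
  }

constantMorphism : CommutativeRing.rawRing ℚ.+-*-commutativeRing -Raw-AlmostCommutative⟶ fromCommutativeRing powerSeriesRing
constantMorphism = record
  { ⟦_⟧    = constant
  ; +-homo = λ p q → λ { zero → refl ; (suc n) → refl }
  ; *-homo = λ p q n → ≡.sym (≡.trans (constant-⊛ p (constant q) n) (lemma p q n))
  ; -‿homo = λ p → λ { zero → refl ; (suc n) → refl }
  ; 0-homo = λ { zero → refl ; (suc n) → refl }
  ; 1-homo = λ _ → refl
  }
  where
  lemma : ∀ p q n → p ℚ.* constant q n ≡ constant (p ℚ.* q) n
  lemma p q zero    = refl
  lemma p q (suc n) = ℚ.*-zeroʳ p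

𝕥 : PowerSeries
𝕥 zero    = 0ℚ
𝕥 (suc n) = constant 1ℚ n

𝕥-⊛-zero : ∀ F → (𝕥 ⊛ F) 0 ≡ 0ℚ
𝕥-⊛-zero F = ≡.trans (⊛-head 𝕥 F) (ℚ.*-zeroˡ (F 0))

𝕥-⊛-suc : ∀ F n → (𝕥 ⊛ F) (suc n) ≡ F n
𝕥-⊛-suc F n = ≡.trans (cong₂ ℚ._+_ (ℚ.*-zeroˡ (F (suc n))) (⊛-identityˡ F n)) (ℚ.+-identityˡ (F n))

toSeries-∷ : ∀ q qs → toSeries (q ∷ qs) ≗ constant q ⊕ 𝕥 ⊛ toSeries qs
toSeries-∷ q qs zero    = ≡.sym (≡.trans (cong (q ℚ.+_) (𝕥-⊛-zero (toSeries qs))) (ℚ.+-identityʳ q))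
toSeries-∷ q qs (suc n) = ≡.sym (≡.trans (ℚ.+-identityˡ _) (𝕥-⊛-suc (toSeries qs) n))

-- Elimination of D and G in a commutative ring over ℚ

module Quadratic {a ℓ} (A : CommutativeRing a ℓ)
  (ℚ⟶A : CommutativeRing.rawRing ℚ.+-*-commutativeRing -Raw-AlmostCommutative⟶ fromCommutativeRing A)
  where
  open CommutativeRing A renaming (refl to ≈-refl; sym to ≈-sym; trans to ≈-trans)
  open _-Raw-AlmostCommutative⟶_ ℚ⟶A

  ⟦⟧-≟ : ∀ p q → Maybe (⟦ p ⟧ ≈ ⟦ q ⟧)
  ⟦⟧-≟ p q with p ℚ.≟ q
  ... | yes refl = just ≈-refl
  ... | no _     = nothing

  open Algebra.Solver.Ring (CommutativeRing.rawRing ℚ.+-*-commutativeRing) (fromCommutativeRing A) ℚ⟶A ⟦⟧-≟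
    using (solve; _:=_; _:+_; _:*_; _:-_; :-_; con)
  open import Algebra.Properties.Group +-group using () renaming (x≈y⇒x∙y⁻¹≈ε to x≈y⇒x-y≈0)
  open import Relation.Binary.Reasoning.Setoid setoid

  -- With Q = 1 − 2 S T D, a square root of 1 − 4 S T, the equations for G and H give
  -- Q (2 S² T H + B) = B + C T; squaring eliminates Q.

  quadratic : ∀ {T S P R B C D G H} →
    D ≈ ⟦ 1ℚ ⟧ + T * (S * (D * D)) →
    G ≈ T * (P * (D * D) + S * (G * D + D * G)) →
    H ≈ R * D + G →
    B ≈ P - R * S →
    C ≈ ⟦ 4ℚ ⟧ * (R * (S * S)) - ⟦ 2ℚ ⟧ * (S * P) →
    (⟦ 1ℚ ⟧ - ⟦ 4ℚ ⟧ * S * T) * ((⟦ 2ℚ ⟧ * (S * S) * T * H + B) * (⟦ 2ℚ ⟧ * (S * S) * T * H + B))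
      ≈ (B + C * T) * (B + C * T)
  quadratic {T} {S} {P} {R} {B} {C} {D} {G} {H} D-eq G-eq H-eq B-eq C-eq = begin
    (⟦ 1ℚ ⟧ - ⟦ 4ℚ ⟧ * S * T) * (Z * Z)  ≈⟨ *-congʳ QQ ⟨
    (Q * Q) * (Z * Z)                     ≈⟨ solve 2 (λ q z → (q :* q) :* (z :* z) := (q :* z) :* (q :* z)) ≈-refl Q Z ⟩
    (Q * Z) * (Q * Z)                     ≈⟨ *-cong QZ QZ ⟩
    (B + C * T) * (B + C * T)             ∎
    where
    Q Z E₁ E₂ : Carrier
    Q = ⟦ 1ℚ ⟧ - ⟦ 2ℚ ⟧ * S * T * D
    Z = ⟦ 2ℚ ⟧ * (S * S) * T * H + B
    E₁ = D - (⟦ 1ℚ ⟧ + T * (S * (D * D)))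
    E₂ = G - T * (P * (D * D) + S * (G * D + D * G))
    -- The solver proves identities of polynomials only. A hypothesis therefore enters as an
    -- explicit multiple of `E₁` or `E₂`, the difference of its two sides, and that multiple is then
    -- dropped.
    vanish : ∀ x y {e} → e ≈ 0# → x + y * e ≈ x
    vanish x y {e} e≈0 = begin
      x + y * e   ≈⟨ +-congˡ (*-congˡ e≈0) ⟩
      x + y * 0#  ≈⟨ +-congˡ (zeroʳ y) ⟩
      x + 0#      ≈⟨ +-identityʳ x ⟩
      x           ∎
    QQ : Q * Q ≈ ⟦ 1ℚ ⟧ - ⟦ 4ℚ ⟧ * S * T
    QQ = begin
      Q * Q
        ≈⟨ solve 3 (λ S T D →
             (con 1ℚ :- con 2ℚ :* S :* T :* D) :* (con 1ℚ :- con 2ℚ :* S :* T :* D) :=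
             con 1ℚ :- con 4ℚ :* S :* T :+ (:- (con 4ℚ :* S :* T)) :* (D :- (con 1ℚ :+ T :* (S :* (D :* D)))))
             ≈-refl S T D ⟩
      ⟦ 1ℚ ⟧ - ⟦ 4ℚ ⟧ * S * T + (- (⟦ 4ℚ ⟧ * S * T)) * E₁
        ≈⟨ vanish _ (- (⟦ 4ℚ ⟧ * S * T)) (x≈y⇒x-y≈0 D-eq) ⟩
      ⟦ 1ℚ ⟧ - ⟦ 4ℚ ⟧ * S * T  ∎
    -- The hypotheses give Q D = 2 - D and S Q G = P (D - 1). Hence Q times 2 S² T (R D + G) is
    -- affine in D, with D-coefficient 2 S T (P - R S). The value B = P - R S is the one for which Q
    -- B cancels this term, and C collects what is left at T.
    QZ : Q * Z ≈ B + C * T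
    QZ = begin
      Q * Z
        ≈⟨ *-congˡ (+-cong (*-congˡ H-eq) B-eq) ⟩
      Q * (⟦ 2ℚ ⟧ * (S * S) * T * (R * D + G) + (P - R * S))
        ≈⟨ solve 6 (λ S P R T D G →
             (con 1ℚ :- con 2ℚ :* S :* T :* D) :* (con 2ℚ :* (S :* S) :* T :* (R :* D :+ G) :+ (P :- R :* S)) :=
             P :- R :* S :+ (con 4ℚ :* (R :* (S :* S)) :- con 2ℚ :* (S :* P)) :* T
             :+ (con 4ℚ :* R :* S :* S :* T :- con 2ℚ :* S :* T :* P) :* (D :- (con 1ℚ :+ T :* (S :* (D :* D))))
             :+ (con 2ℚ :* S :* S :* T) :* (G :- T :* (P :* (D :* D) :+ S :* (G :* D :+ D :* G))))
             ≈-refl S P R T D G ⟩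
      P - R * S + (⟦ 4ℚ ⟧ * (R * (S * S)) - ⟦ 2ℚ ⟧ * (S * P)) * T
        + (⟦ 4ℚ ⟧ * R * S * S * T - ⟦ 2ℚ ⟧ * S * T * P) * E₁
        + (⟦ 2ℚ ⟧ * S * S * T) * E₂
        ≈⟨ ≈-trans (vanish _ (⟦ 2ℚ ⟧ * S * S * T) (x≈y⇒x-y≈0 G-eq))
             (vanish _ (⟦ 4ℚ ⟧ * R * S * S * T - ⟦ 2ℚ ⟧ * S * T * P) (x≈y⇒x-y≈0 D-eq)) ⟩
      P - R * S + (⟦ 4ℚ ⟧ * (R * (S * S)) - ⟦ 2ℚ ⟧ * (S * P)) * T
        ≈⟨ +-cong B-eq (*-congʳ C-eq) ⟨
      B + C * T  ∎

  -- The nesting copies `toSeries`, as that of `horner₂` copies `eval`. The empty case is the image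
  -- of `0ℚ`, which is what `con 0ℚ` denotes in the solver.
  horner : List ℚ → Carrier → Carrier
  horner []       T = ⟦ 0ℚ ⟧
  horner (q ∷ qs) T = ⟦ q ⟧ + T * horner qs T

  horner₂ : List (List ℚ) → Carrier → Carrier → Carrier
  horner₂ []       T H = ⟦ 0ℚ ⟧
  horner₂ (q ∷ qs) T H = horner q T + H * horner₂ qs T H

  module _ (s ρ r : ℚ) where
    private
      16ℚ β γ : ℚ
      16ℚ = 4ℚ ℚ.* 4ℚ
      β = ρ ℚ.+ ℚ.- (r ℚ.* s)
      γ = 4ℚ ℚ.* (r ℚ.* (s ℚ.* s)) ℚ.+ ℚ.- (2ℚ ℚ.* (s ℚ.* ρ))

    -- The coefficients in x of (1 − 4 s t) (2 s² t x + β)² − (β + γ t)².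

    polynomial : List (List ℚ)
    polynomial =
      (0ℚ ∷ ℚ.- (4ℚ ℚ.* (s ℚ.* (β ℚ.* β)) ℚ.+ 2ℚ ℚ.* (β ℚ.* γ)) ∷ ℚ.- (γ ℚ.* γ) ∷ []) ∷
      (0ℚ ∷ 4ℚ ℚ.* (β ℚ.* (s ℚ.* s)) ∷ ℚ.- (16ℚ ℚ.* (β ℚ.* (s ℚ.* (s ℚ.* s)))) ∷ []) ∷
      (0ℚ ∷ 0ℚ ∷ 4ℚ ℚ.* (s ℚ.* (s ℚ.* (s ℚ.* s))) ∷ ℚ.- (16ℚ ℚ.* (s ℚ.* (s ℚ.* (s ℚ.* (s ℚ.* s))))) ∷ []) ∷ []

    horner₂-polynomial : ∀ {T D G H} →
      D ≈ ⟦ 1ℚ ⟧ + T * (⟦ s ⟧ * (D * D)) →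
      G ≈ T * (⟦ ρ ⟧ * (D * D) + ⟦ s ⟧ * (G * D + D * G)) →
      H ≈ ⟦ r ⟧ * D + G →
      horner₂ polynomial T H ≈ 0#
    horner₂-polynomial {T} {D} {G} {H} D-eq G-eq H-eq = begin
      horner₂ polynomial T H
        -- The coefficients are images of composite rationals. The homomorphism laws push `⟦_⟧`
        -- inwards as far as s, β and γ, which become variables of the next identity; β and γ are
        -- expanded only when `quadratic` is applied.
        ≈⟨ +-cong
             (coefficients ≈-refl
               (⟦-⟧ (⟦+⟧ (⟦*⟧ ≈-refl (⟦*⟧ ≈-refl (⟦*⟧ ≈-refl ≈-refl))) (⟦*⟧ ≈-refl (⟦*⟧ ≈-refl ≈-refl))))
               (+-congʳ (⟦-⟧ (⟦*⟧ ≈-refl ≈-refl))))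
             (*-congˡ (+-cong
               (coefficients ≈-refl
                 (⟦*⟧ ≈-refl (⟦*⟧ ≈-refl (⟦*⟧ ≈-refl ≈-refl)))
                 (+-congʳ (⟦-⟧ (⟦*⟧ (⟦*⟧ ≈-refl ≈-refl) (⟦*⟧ ≈-refl (⟦*⟧ ≈-refl (⟦*⟧ ≈-refl ≈-refl)))))))
               (*-congˡ (+-congʳ (coefficients ≈-refl ≈-refl (+-cong
                 (⟦*⟧ ≈-refl (⟦*⟧ ≈-refl (⟦*⟧ ≈-refl (⟦*⟧ ≈-refl ≈-refl))))
                 (*-congˡ (+-congʳ (⟦-⟧ (⟦*⟧ (⟦*⟧ ≈-refl ≈-refl)
                   (⟦*⟧ ≈-refl (⟦*⟧ ≈-refl (⟦*⟧ ≈-refl (⟦*⟧ ≈-refl ≈-refl)))))))))))))) ⟩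
      _ ≈⟨ solve 5 (λ T H S B C →
             let 0! = con 0ℚ
                 Z = con 2ℚ :* (S :* S) :* T :* H :+ B
                 W = B :+ C :* T
             in (0! :+ T :* (:- (con 4ℚ :* (S :* (B :* B)) :+ con 2ℚ :* (B :* C)) :+ T :* (:- (C :* C) :+ T :* 0!)))
                :+ H :* ((0! :+ T :* (con 4ℚ :* (B :* (S :* S))
                     :+ T :* (:- (con 4ℚ :* con 4ℚ :* (B :* (S :* (S :* S)))) :+ T :* 0!)))
                :+ H :* ((0! :+ T :* (0! :+ T :* (con 4ℚ :* (S :* (S :* (S :* S)))
                     :+ T :* (:- (con 4ℚ :* con 4ℚ :* (S :* (S :* (S :* (S :* S))))) :+ T :* 0!))))
                :+ H :* 0!))
                := (con 1ℚ :- con 4ℚ :* S :* T) :* (Z :* Z) :- W :* W)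
             ≈-refl T H ⟦ s ⟧ ⟦ β ⟧ ⟦ γ ⟧ ⟩
      _ ≈⟨ x≈y⇒x-y≈0 (quadratic D-eq G-eq H-eq (⟦+⟧ ≈-refl (⟦-⟧ (⟦*⟧ ≈-refl ≈-refl)))
          (⟦+⟧ (⟦*⟧ ≈-refl (⟦*⟧ ≈-refl (⟦*⟧ ≈-refl ≈-refl))) (⟦-⟧ (⟦*⟧ ≈-refl (⟦*⟧ ≈-refl ≈-refl))))) ⟩
      0# ∎
      where
      ⟦*⟧ : ∀ {p q x y} → ⟦ p ⟧ ≈ x → ⟦ q ⟧ ≈ y → ⟦ p ℚ.* q ⟧ ≈ x * y
      ⟦*⟧ {p} {q} p≈x q≈y = ≈-trans (*-homo p q) (*-cong p≈x q≈y)
      ⟦+⟧ : ∀ {p q x y} → ⟦ p ⟧ ≈ x → ⟦ q ⟧ ≈ y → ⟦ p ℚ.+ q ⟧ ≈ x + y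
      ⟦+⟧ {p} {q} p≈x q≈y = ≈-trans (+-homo p q) (+-cong p≈x q≈y)
      ⟦-⟧ : ∀ {p x} → ⟦ p ⟧ ≈ x → ⟦ ℚ.- p ⟧ ≈ - x
      ⟦-⟧ {p} p≈x = ≈-trans (-‿homo p) (-‿cong p≈x)
      coefficients : ∀ {a a′ β β′ γ γ′} → a ≈ a′ → β ≈ β′ → γ ≈ γ′ → a + T * (β + T * γ) ≈ a′ + T * (β′ + T * γ′)
      coefficients a≈ β≈ γ≈ = +-cong a≈ (*-congˡ (+-cong β≈ (*-congˡ γ≈)))

open Quadratic powerSeriesRing constantMorphism

toSeries-horner : ∀ qs → toSeries qs ≗ horner qs 𝕥
toSeries-horner []       zero    = refl
toSeries-horner []       (suc n) = refl
toSeries-horner (q ∷ qs) n = ≡.trans (toSeries-∷ q qs n)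
  (cong (constant q n ℚ.+_) (⊛-cong {𝕥} (λ _ → refl) (toSeries-horner qs) n))

eval-horner₂ : ∀ qs F → eval qs F ≗ horner₂ qs 𝕥 F
eval-horner₂ []       F zero    = refl
eval-horner₂ []       F (suc n) = refl
eval-horner₂ (q ∷ qs) F n = cong₂ ℚ._+_ (toSeries-horner q n) (⊛-cong {F} (λ _ → refl) (eval-horner₂ qs F) n)

ℕ⇒ℚ-* : ∀ {m n x y} → ℕ⇒ℚ m ≡ x → ℕ⇒ℚ n ≡ y → ℕ⇒ℚ (m ℕ.* n) ≡ x ℚ.* y
ℕ⇒ℚ-* {m} {n} refl refl = ℕ⇒ℚ-homo-* m n

-- The rational is the image of the natural number 4 s⁴, so injectivity of `ℕ⇒ℚ` moves the claim to
-- ℕ, where products of nonzero numbers are nonzero.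
leading≢0 : ∀ s .{{_ : ℕ.NonZero s}} → let q = ℕ⇒ℚ s in 4ℚ ℚ.* (q ℚ.* (q ℚ.* (q ℚ.* q))) ≢ 0ℚ
leading≢0 s eq = ℕ.≢-nonZero⁻¹ (4 ℕ.* s⁴) (ℕ⇒ℚ-injective {4 ℕ.* s⁴} {0} (≡.trans
  (ℕ⇒ℚ-* {4} {s⁴} refl (ℕ⇒ℚ-* {s} {s³} refl (ℕ⇒ℚ-* {s} {s²} refl (ℕ⇒ℚ-homo-* s s)))) eq))
  where
  s² = s ℕ.* s
  s³ = s ℕ.* s²
  s⁴ = s ℕ.* s³
  instance
    s²≢0 : ℕ.NonZero s²
    s²≢0 = ℕ.m*n≢0 s s
    s³≢0 : ℕ.NonZero s³
    s³≢0 = ℕ.m*n≢0 s s²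
    s⁴≢0 : ℕ.NonZero s⁴
    s⁴≢0 = ℕ.m*n≢0 s s³
    4s⁴≢0 : ℕ.NonZero (4 ℕ.* s⁴)
    4s⁴≢0 = ℕ.m*n≢0 4 s⁴

algebraic : ∀ (s ρ r : ℕ) .{{_ : ℕ.NonZero s}} {D G H} →
            D ≗ constant 1ℚ ⊕ 𝕥 ⊛ (constant (ℕ⇒ℚ s) ⊛ (D ⊛ D)) →
            G ≗ 𝕥 ⊛ (constant (ℕ⇒ℚ ρ) ⊛ (D ⊛ D) ⊕ constant (ℕ⇒ℚ s) ⊛ (G ⊛ D ⊕ D ⊛ G)) →
            H ≗ constant (ℕ⇒ℚ r) ⊛ D ⊕ G →
            IsAlgebraic H
algebraic s ρ r {D} {G} {H} D-eq G-eq H-eq =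
  -- The path leads to the coefficient of x² t². It is 4 s⁴, whatever the values of β and γ, which
  -- may both be zero.
  polynomial (ℕ⇒ℚ s) (ℕ⇒ℚ ρ) (ℕ⇒ℚ r) , there (there (here (there (there (here (leading≢0 s)))))) ,
  λ n → ≡.trans (eval-horner₂ (polynomial (ℕ⇒ℚ s) (ℕ⇒ℚ ρ) (ℕ⇒ℚ r)) H n)
    (horner₂-polynomial (ℕ⇒ℚ s) (ℕ⇒ℚ ρ) (ℕ⇒ℚ r) {𝕥} {D} {G} {H} D-eq G-eq H-eq n)

-- Congruences modulo p without subtraction

-- Modulo p = 1 + q, multiplication by q plays the role of negation.

%-≡⇒∣ : ∀ q m n → m % suc q ≡ n % suc q → suc q ∣ m ℕ.+ q ℕ.* n
%-≡⇒∣ q m n eq = m%n≡0⇒n∣m (m ℕ.+ q ℕ.* n) p (begin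
  (m ℕ.+ q ℕ.* n) % p                  ≡⟨ %-distribˡ-+ m (q ℕ.* n) p ⟩
  (m % p ℕ.+ (q ℕ.* n) % p) % p        ≡⟨ cong (λ k → (k ℕ.+ (q ℕ.* n) % p) % p) eq ⟩
  (n % p ℕ.+ (q ℕ.* n) % p) % p        ≡⟨ %-distribˡ-+ n (q ℕ.* n) p ⟨
  (p ℕ.* n) % p                        ≡⟨ cong (_% p) (ℕ.*-comm p n) ⟩
  (n ℕ.* p) % p                        ≡⟨ m*n%n≡0 n p ⟩
  0                                    ∎)
  where
  p = suc q
  open ≡.≡-Reasoning

-- Adding n to m + q n gives m + p n, which leaves the remainder m; as p divides m + q n, it also
-- leaves the remainder n.
∣⇒≡ : ∀ q {m n} → m < suc q → n < suc q → suc q ∣ m ℕ.+ q ℕ.* n → m ≡ n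
∣⇒≡ q {m} {n} m<p n<p (divides k eq) = begin
  m                              ≡⟨ m<n⇒m%n≡m m<p ⟨
  m % p                          ≡⟨ [m+kn]%n≡m%n m n p ⟨
  (m ℕ.+ n ℕ.* p) % p            ≡⟨ cong (λ x → (m ℕ.+ x) % p) (≡.trans (ℕ.*-comm n p) (ℕ.+-comm n (q ℕ.* n))) ⟩
  (m ℕ.+ (q ℕ.* n ℕ.+ n)) % p    ≡⟨ cong (_% p) (ℕ.+-assoc m (q ℕ.* n) n) ⟨
  (m ℕ.+ q ℕ.* n ℕ.+ n) % p      ≡⟨ cong (λ x → (x ℕ.+ n) % p) eq ⟩
  (k ℕ.* p ℕ.+ n) % p            ≡⟨ cong (_% p) (ℕ.+-comm (k ℕ.* p) n) ⟩
  (n ℕ.+ k ℕ.* p) % p            ≡⟨ [m+kn]%n≡m%n n k p ⟩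
  n % p                          ≡⟨ m<n⇒m%n≡m n<p ⟩
  n                              ∎
  where
  p = suc q
  open ≡.≡-Reasoning

funToFin-cong : ∀ {m n} {f g : Fin m → Fin n} → (∀ i → f i ≡ g i) → funToFin f ≡ funToFin g
funToFin-cong {zero}  f≗g = refl
funToFin-cong {suc m} f≗g = cong₂ Fin.combine (f≗g zero) (funToFin-cong (f≗g ∘ suc))

prime∤⇒coprime : ∀ {p n} → Prime p → ¬ p ∣ n → Coprime p n
prime∤⇒coprime p-prime p∤n (d∣p , d∣n) with prime⇒irreducible p-prime d∣p
... | inj₁ d≡1  = d≡1
... | inj₂ refl = contradiction d∣n p∤n

-- Bases modulo p and ranks of finite abelian groups

module _ (G : AbelianGroup a ℓ) where
  open AbelianGroup G renaming (refl to ≈-refl; sym to ≈-sym; trans to ≈-trans)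
  open CommutativeMonoidMult commutativeMonoid
    using (×-congʳ; ×-homo-+; ×-assocˡ; ×-distrib-+) renaming (_×_ to _×ℕ_)
  open CommutativeMonoidSum commutativeMonoid
    using (sum-cong-≋; ∑-distrib-+; sum-remove; sum-replicate-zero) renaming (sum to ⨁)
  open CommutativeSemigroupProperties (CommutativeMonoid.commutativeSemigroup commutativeMonoid) using (interchange)
  open SetoidReasoning setoid

  combination : ∀ {k} → (Fin k → ℕ) → (Fin k → Carrier) → Carrier
  combination n g = ⨁ (λ i → n i ×ℕ g i)

  Spans : ∀ {k} → (Fin k → Carrier) → Set (a ⊔ ℓ)
  Spans g = ∀ x → ∃ λ n → combination n g ≈ x

  -- Natural coefficients suffice in a torsion group. Independence is modulo p:
  -- the image of a basis is a basis of G / pG over the field with p elements.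

  record HasBasis (p r : ℕ) : Set (a ⊔ ℓ) where
    field
      basis       : Fin r → Carrier
      spans       : Spans basis
      independent : ∀ n y → combination n basis ≈ p ×ℕ y → ∀ i → p ∣ n i

  combination-+ : ∀ {k} m n (g : Fin k → Carrier) →
                  combination (λ i → m i ℕ.+ n i) g ≈ combination m g ∙ combination n g
  combination-+ m n g = ≈-trans (sum-cong-≋ (λ i → ×-homo-+ (g i) (m i) (n i)))
    (∑-distrib-+ (λ i → m i ×ℕ g i) (λ i → n i ×ℕ g i))

  ×-ε : ∀ c → c ×ℕ ε ≈ ε
  ×-ε zero    = ≈-refl
  ×-ε (suc c) = ≈-trans (identityˡ _) (×-ε c)

  combination-* : ∀ {k} c n (g : Fin k → Carrier) →
                  combination (λ i → c ℕ.* n i) g ≈ c ×ℕ combination n g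
  combination-* {zero}  c n g = ≈-sym (×-ε c)
  combination-* {suc k} c n g = ≈-trans
    (∙-cong (≈-sym (×-assocˡ (g zero) c (n zero))) (combination-* c (n ∘ suc) (g ∘ suc)))
    (≈-sym (×-distrib-+ _ _ c))

  ⨁-↑ : ∀ r {s} (f : Fin (r ℕ.+ s) → Carrier) → ⨁ f ≈ ⨁ (λ i → f (i ↑ˡ s)) ∙ ⨁ (λ j → f (r ↑ʳ j))
  ⨁-↑ zero    f = ≈-sym (identityˡ _)
  ⨁-↑ (suc r) f = ≈-trans (∙-congˡ (⨁-↑ r (f ∘ suc))) (≈-sym (assoc _ _ _))

  combination-splitAt : ∀ {r s} n (g : Fin r → Carrier) (h : Fin s → Carrier) →
    combination n ([ g , h ] ∘ splitAt r) ≈ combination (λ i → n (i ↑ˡ s)) g ∙ combination (λ j → n (r ↑ʳ j)) h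
  combination-splitAt {r} {s} n g h = ≈-trans (⨁-↑ r _) (∙-cong
    (sum-cong-≋ λ i → reflexive (cong (λ x → n (i ↑ˡ s) ×ℕ [ g , h ] x) (Fin.splitAt-↑ˡ r i s)))
    (sum-cong-≋ λ j → reflexive (cong (λ x → n (r ↑ʳ j) ×ℕ [ g , h ] x) (Fin.splitAt-↑ʳ r s j))))

  combination-cong : ∀ {k} {m n : Fin k → ℕ} {g h : Fin k → Carrier} →
                     (∀ i → m i ≡ n i) → (∀ i → g i ≡ h i) → combination m g ≈ combination n h
  combination-cong m≗n g≗h = sum-cong-≋ λ i → reflexive (cong₂ _×ℕ_ (m≗n i) (g≗h i))

  combination-ε : ∀ {k} (n : Fin k → ℕ) → combination n (λ _ → ε) ≈ ε
  combination-ε {k} n = ≈-trans (sum-cong-≋ (λ i → ×-ε (n i))) (sum-replicate-zero k)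

  trivial-hasBasis : ∀ p → (∀ x → x ≈ ε) → HasBasis p 0
  trivial-hasBasis p ≈ε = record
    { basis       = λ ()
    ; spans       = λ x → (λ ()) , ≈-sym (≈ε x)
    ; independent = λ _ _ _ ()
    }

  module _ (F : FiniteCover setoid) where
    open RankExists G F using (reduce)

    generates⇒spans : ∀ {k} (g : Fin k → Carrier) → Generates G g → Spans g
    generates⇒spans g gen x =
      let z , eq = gen x
      in (λ i → toℕ (proj₁ (reduce (z i) (g i)))) , ≈-trans (sum-cong-≋ (λ i → proj₂ (reduce (z i) (g i)))) eq

    -- Pigeonhole: there are p ^ r combinations of the basis with digits below p. Writing them in j
    -- generators and reducing the coefficients modulo p leaves p ^ j possibilities. If j < r, two
    -- combinations agree there, so their difference lies in p G; independence makes their digits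
    -- congruent, hence equal.
    hasBasis⇒rank≤ : ∀ {q r j} → HasBasis (2 ℕ.+ q) r → GeneratedBy G j → r ≤ j
    hasBasis⇒rank≤ {q} {r} {j} B (h , gen) = ℕ.≮⇒≥ λ j<r →
      let k , l , k<l , eq = Fin.pigeonhole (ℕ.^-monoʳ-< p (ℕ.s<s ℕ.z<s) j<r) reduced
      in contradiction (collision-≡ k l eq) (Fin.<⇒≢ k<l)
      where
      open HasBasis B
      p = 2 ℕ.+ q
      digits : Fin (p ^ r) → Fin r → ℕ
      digits k i = toℕ (finToFun {p} {r} k i)
      coefficients : Fin (p ^ r) → Fin j → ℕ
      coefficients k = proj₁ (generates⇒spans h gen (combination (digits k) basis))
      coefficients-eq : ∀ k → combination (coefficients k) h ≈ combination (digits k) basis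
      coefficients-eq k = proj₂ (generates⇒spans h gen (combination (digits k) basis))
      residue : Fin (p ^ r) → Fin j → Fin p
      residue k i = fromℕ< (m%n<n (coefficients k i) p)
      reduced : Fin (p ^ r) → Fin (p ^ j)
      reduced k = funToFin (residue k)
      collision-≡ : ∀ k l → reduced k ≡ reduced l → k ≡ l
      collision-≡ k l eq = ≡.trans (≡.sym (Fin.funToFin-finToFin {r} {p} k)) (≡.trans
        (funToFin-cong λ i → Fin.toℕ-injective
          (∣⇒≡ (suc q) (Fin.toℕ<n (finToFun {p} {r} k i)) (Fin.toℕ<n (finToFun {p} {r} l i))
            (independent (λ i → digits k i ℕ.+ suc q ℕ.* digits l i) (combination quotient h) difference i)))
        (Fin.funToFin-finToFin {r} {p} l))
        where
        residue-≡ : ∀ i → coefficients k i % p ≡ coefficients l i % p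
        residue-≡ i = Fin.fromℕ<-injective _ _ (m%n<n (coefficients k i) p) (m%n<n (coefficients l i) p)
          (≡.trans (≡.sym (Fin.finToFun-funToFin (residue k) i))
            (≡.trans (cong (λ x → finToFun x i) eq) (Fin.finToFun-funToFin (residue l) i)))
        p∣ : ∀ i → p ∣ coefficients k i ℕ.+ suc q ℕ.* coefficients l i
        p∣ i = %-≡⇒∣ (suc q) (coefficients k i) (coefficients l i) (residue-≡ i)
        quotient : Fin j → ℕ
        quotient i = _∣_.quotient (p∣ i)
        -- Here `suc q` is p - 1 and acts as -1 modulo p, so the left side is the difference of the
        -- two combinations up to an element of p G.
        difference : combination (λ i → digits k i ℕ.+ suc q ℕ.* digits l i) basis ≈ p ×ℕ combination quotient h
        difference = begin
          combination (λ i → digits k i ℕ.+ suc q ℕ.* digits l i) basis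
            ≈⟨ combination-+ (digits k) (λ i → suc q ℕ.* digits l i) basis ⟩
          combination (digits k) basis ∙ combination (λ i → suc q ℕ.* digits l i) basis
            ≈⟨ ∙-cong (≈-sym (coefficients-eq k)) (≈-trans (combination-* (suc q) (digits l) basis)
                 (×-congʳ (suc q) (≈-sym (coefficients-eq l)))) ⟩
          combination (coefficients k) h ∙ suc q ×ℕ combination (coefficients l) h
            ≈⟨ ∙-congˡ (combination-* (suc q) (coefficients l) h) ⟨
          combination (coefficients k) h ∙ combination (λ i → suc q ℕ.* coefficients l i) h
            ≈⟨ combination-+ (coefficients k) (λ i → suc q ℕ.* coefficients l i) h ⟨
          combination (λ i → coefficients k i ℕ.+ suc q ℕ.* coefficients l i) h
            ≈⟨ sum-cong-≋ (λ i → reflexive (cong (_×ℕ h i) (≡.trans (_∣_.equality (p∣ i)) (ℕ.*-comm (quotient i) p)))) ⟩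
          combination (λ i → p ℕ.* quotient i) h
            ≈⟨ combination-* p quotient h ⟩
          p ×ℕ combination quotient h  ∎

    spans⇒generatedBy : ∀ {k} (g : Fin k → Carrier) → Spans g → GeneratedBy G k
    spans⇒generatedBy g sp = g , λ x → let n , eq = sp x in (λ i → + n i) , eq

    hasBasis⇒rank : ∀ {p r} .{{_ : ℕ.NonTrivial p}} → HasBasis p r → ∀ {k} → IsRank G k → k ≡ r
    hasBasis⇒rank {p = suc (suc q)} B (gen , least) =
      ℕ.≤-antisym (least _ (spans⇒generatedBy (HasBasis.basis B) (HasBasis.spans B))) (hasBasis⇒rank≤ B gen)

    -- If some n i in a relation Σ n g ≈ p y were prime to p, then the remaining
    -- generators would span G modulo p G, hence modulo p ^ k G = 0.

    rank⇒hasBasis : ∀ {p r} k → Prime p → (∀ x → (p ^ k) ×ℕ x ≈ ε) → IsRank G r → HasBasis p r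
    rank⇒hasBasis {p} {zero} k p-prime p^k×≈ε ((g , gen) , least) = record
      { basis = g ; spans = generates⇒spans g gen ; independent = λ _ _ _ () }
    rank⇒hasBasis {p} {suc r} k p-prime p^k×≈ε ((g , gen) , least) = record
      { basis = g ; spans = generates⇒spans g gen ; independent = independent }
      where
      independent : ∀ n y → combination n g ≈ p ×ℕ y → ∀ i → p ∣ n i
      independent n y eq i with p ∣? n i
      ... | yes p∣nᵢ = p∣nᵢ
      ... | no  p∤nᵢ = contradiction (least r (spans⇒generatedBy g′ g′-spans)) ℕ.1+n≰n
        where
        g′ : Fin r → Carrier
        g′ = removeAt g i
        -- This is a subgroup, by the closure properties that follow. Once it contains `g i` it is
        -- all of G.
        InSpan : Carrier → Set _
        InSpan x = ∃₂ λ l y → x ≈ combination l g′ ∙ p ×ℕ y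
        resp : ∀ {x y} → x ≈ y → InSpan x → InSpan y
        resp x≈y (l , z , eq) = l , z , ≈-trans (≈-sym x≈y) eq
        ∙-closed : ∀ {x y} → InSpan x → InSpan y → InSpan (x ∙ y)
        ∙-closed {x} {y} (l , v , x≈) (m , w , y≈) = (λ i → l i ℕ.+ m i) , v ∙ w , (begin
          x ∙ y                                                              ≈⟨ ∙-cong x≈ y≈ ⟩
          (combination l g′ ∙ p ×ℕ v) ∙ (combination m g′ ∙ p ×ℕ w)          ≈⟨ interchange _ _ _ _ ⟩
          (combination l g′ ∙ combination m g′) ∙ (p ×ℕ v ∙ p ×ℕ w)          ≈⟨ ∙-cong (combination-+ l m g′) (×-distrib-+ v w p) ⟨
          combination (λ i → l i ℕ.+ m i) g′ ∙ p ×ℕ (v ∙ w)                  ∎)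
        ×-comm : ∀ c d x → c ×ℕ (d ×ℕ x) ≈ d ×ℕ (c ×ℕ x)
        ×-comm c d x = begin
          c ×ℕ (d ×ℕ x)    ≈⟨ ×-assocˡ x c d ⟩
          (c ℕ.* d) ×ℕ x   ≡⟨ cong (_×ℕ x) (ℕ.*-comm c d) ⟩
          (d ℕ.* c) ×ℕ x   ≈⟨ ×-assocˡ x d c ⟨
          d ×ℕ (c ×ℕ x)    ∎
        ×-closed : ∀ c {x} → InSpan x → InSpan (c ×ℕ x)
        ×-closed c {x} (l , v , x≈) = (λ i → c ℕ.* l i) , c ×ℕ v , (begin
          c ×ℕ x                                           ≈⟨ ×-congʳ c x≈ ⟩
          c ×ℕ (combination l g′ ∙ p ×ℕ v)                 ≈⟨ ×-distrib-+ _ _ c ⟩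
          c ×ℕ combination l g′ ∙ c ×ℕ (p ×ℕ v)            ≈⟨ ∙-cong (≈-sym (combination-* c l g′)) (×-comm c p v) ⟩
          combination (λ i → c ℕ.* l i) g′ ∙ p ×ℕ (c ×ℕ v) ∎)
        -- In a finite group an inverse is a natural multiple, so closure under multiples is enough.
        ⁻¹-closed : ∀ {x} → InSpan x → InSpan (x ⁻¹)
        ⁻¹-closed {x} x∈ = let c , c×x≈x⁻¹ = reduce -[1+ 0 ] x in
          resp (≈-trans c×x≈x⁻¹ (⁻¹-cong (identityʳ x))) (×-closed (toℕ c) x∈)
        combination-closed : ∀ l → InSpan (combination l g′)
        combination-closed l = l , ε , ≈-sym (≈-trans (∙-congˡ (×-ε p)) (identityʳ _))
        p×-closed : ∀ y → InSpan (p ×ℕ y)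
        p×-closed y = (λ _ → 0) , y , ≈-sym (≈-trans (∙-congʳ (sum-replicate-zero r)) (identityˡ _))
        cancelˡ : ∀ {x} y → InSpan (x ∙ y) → InSpan y → InSpan x
        cancelˡ {x} y xy∈ y∈ = resp (≈-trans (assoc x y (y ⁻¹)) (≈-trans (∙-congˡ (inverseʳ y)) (identityʳ x)))
          (∙-closed xy∈ (⁻¹-closed y∈))
        nᵢgᵢ∈ : InSpan (n i ×ℕ g i)
        nᵢgᵢ∈ = cancelˡ (combination (removeAt n i) g′)
          (resp (≈-trans (≈-sym eq) (sum-remove {i = i} (λ j → n j ×ℕ g j))) (p×-closed y))
          (combination-closed (removeAt n i))
        -- The two multiples u c and v d of `g i` differ by exactly `g i`. Keeping c and d open
        -- covers both signs of Bézout's identity, with p and `n i` in either role.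
        bézout : ∀ {u v c d} → InSpan (c ×ℕ g i) → InSpan (d ×ℕ g i) → 1 ℕ.+ u ℕ.* c ≡ v ℕ.* d → InSpan (g i)
        bézout {u} {v} {c} {d} c∈ d∈ eq = cancelˡ ((u ℕ.* c) ×ℕ g i)
          (resp (≈-trans (×-assocˡ (g i) v d) (reflexive (cong (_×ℕ g i) (≡.sym eq)))) (×-closed v d∈))
          (resp (×-assocˡ (g i) u c) (×-closed u c∈))
        gᵢ∈ : InSpan (g i)
        gᵢ∈ with coprime-Bézout (prime∤⇒coprime p-prime p∤nᵢ)
        ... | Bézout.+- u v eq = bézout {v} {u} nᵢgᵢ∈ (p×-closed (g i)) eq
        ... | Bézout.-+ u v eq = bézout {u} {v} (p×-closed (g i)) nᵢgᵢ∈ eq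
        all∈ : ∀ x → InSpan x
        all∈ x = let m , eq = generates⇒spans g gen x in
          resp (≈-trans (≈-sym (sum-remove {i = i} (λ j → m j ×ℕ g j))) eq)
            (∙-closed (×-closed (m i) gᵢ∈) (combination-closed (removeAt m i)))
        -- Nakayama's argument: decomposing the remainder y once more moves the error from p ^ e G
        -- to p ^ (e + 1) G. At the exponent k the error is zero.
        modulo-power : ∀ e x → ∃₂ λ l y → x ≈ combination l g′ ∙ (p ^ e) ×ℕ y
        modulo-power zero    x = (λ _ → 0) , x ,
          ≈-sym (≈-trans (∙-cong (sum-replicate-zero r) (identityʳ x)) (identityˡ x))
        modulo-power (suc e) x =
          let l , y , x≈ = modulo-power e x
              m , z , y≈ = all∈ y
          in (λ i → l i ℕ.+ p ^ e ℕ.* m i) , z , (begin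
            x
              ≈⟨ x≈ ⟩
            combination l g′ ∙ (p ^ e) ×ℕ y
              ≈⟨ ∙-congˡ (≈-trans (×-congʳ (p ^ e) y≈) (×-distrib-+ _ _ (p ^ e))) ⟩
            combination l g′ ∙ ((p ^ e) ×ℕ combination m g′ ∙ (p ^ e) ×ℕ (p ×ℕ z))
              ≈⟨ assoc _ _ _ ⟨
            (combination l g′ ∙ (p ^ e) ×ℕ combination m g′) ∙ (p ^ e) ×ℕ (p ×ℕ z)
              ≈⟨ ∙-cong (≈-trans (∙-congˡ (≈-sym (combination-* (p ^ e) m g′))) (≈-sym (combination-+ l _ g′)))
                        (≈-trans (×-comm (p ^ e) p z) (×-assocˡ z p (p ^ e))) ⟩
            combination (λ i → l i ℕ.+ p ^ e ℕ.* m i) g′ ∙ (p ^ suc e) ×ℕ z  ∎)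
        g′-spans : Spans g′
        g′-spans x = let l , y , x≈ = modulo-power k x in
          l , ≈-sym (≈-trans x≈ (≈-trans (∙-congˡ (p^k×≈ε y)) (identityʳ _)))

-- Bases under isomorphisms and in products

module _ {G : AbelianGroup a ℓ} {H : AbelianGroup b ℓ′} where
  private
    module G = AbelianGroup G
    module H = AbelianGroup H
    open CommutativeMonoidMult G.commutativeMonoid using () renaming (_×_ to _×ᴳ_)
    open CommutativeMonoidMult H.commutativeMonoid using (×-congʳ) renaming (_×_ to _×ᴴ_)
    open CommutativeMonoidSum H.commutativeMonoid using (sum-cong-≋)
  open MonoidMorphisms G.rawMonoid H.rawMonoid

  module _ {φ : G.Carrier → H.Carrier} (φ-homo : IsMonoidHomomorphism φ) where
    open IsMonoidHomomorphism φ-homo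

    ×-homo : ∀ n x → φ (n ×ᴳ x) H.≈ n ×ᴴ φ x
    ×-homo zero    x = ε-homo
    ×-homo (suc n) x = H.trans (homo x (n ×ᴳ x)) (H.∙-congˡ (×-homo n x))

    combination-homo : ∀ {k} n (g : Fin k → G.Carrier) → φ (combination G n g) H.≈ combination H n (φ ∘ g)
    combination-homo {zero}  n g = ε-homo
    combination-homo {suc k} n g = H.trans (homo _ _)
      (H.∙-cong (×-homo (n zero) (g zero)) (combination-homo (n ∘ suc) (g ∘ suc)))

  hasBasis-iso : ∀ {φ p r} → IsMonoidIsomorphism φ → HasBasis H p r → HasBasis G p r
  hasBasis-iso {φ} {p} {r} iso B = record
    { basis       = basis′
    ; spans       = λ x →
        let n , eq = spans (φ x)
        in n , injective (H.trans (combination-basis′ n) eq)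
    ; independent = λ n y eq → independent n (φ y)
        (H.trans (H.sym (combination-basis′ n)) (H.trans (⟦⟧-cong eq) (×-homo isMonoidHomomorphism p y)))
    }
    where
    open IsMonoidIsomorphism iso
    open HasBasis B
    basis′ : Fin r → G.Carrier
    basis′ i = proj₁ (surjective (basis i))
    combination-basis′ : ∀ n → φ (combination G n basis′) H.≈ combination H n basis
    combination-basis′ n = H.trans (combination-homo isMonoidHomomorphism n basis′)
      (sum-cong-≋ λ i → ×-congʳ (n i) (proj₂ (surjective (basis i)) G.refl))

module _ {G : AbelianGroup a ℓ} {H : AbelianGroup b ℓ′} where
  private
    module G = AbelianGroup G
    module H = AbelianGroup H
    G×H = DirectProduct.abelianGroup G H
    module G×H = AbelianGroup G×H

  proj₁-homo : MonoidMorphisms.IsMonoidHomomorphism G×H.rawMonoid G.rawMonoid proj₁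
  proj₁-homo = record
    { isMagmaHomomorphism = record
      { isRelHomomorphism = record { cong = proj₁ } ; homo = λ _ _ → G.refl }
    ; ε-homo = G.refl
    }

  proj₂-homo : MonoidMorphisms.IsMonoidHomomorphism G×H.rawMonoid H.rawMonoid proj₂
  proj₂-homo = record
    { isMagmaHomomorphism = record
      { isRelHomomorphism = record { cong = proj₂ } ; homo = λ _ _ → H.refl }
    ; ε-homo = H.refl
    }

  -- Additivity of the rank comes from here: a combination of the joint basis has one half of its
  -- coefficients in each coordinate, and a p-fold multiple in the product is one in each
  -- coordinate.
  hasBasis-× : ∀ {p r s} → HasBasis G p r → HasBasis H p s → HasBasis G×H p (r ℕ.+ s)
  hasBasis-× {p} {r} {s} B C = record
    { basis       = basis
    ; spans       = λ (x , y) →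
        let m , m≈x = B.spans x
            n , n≈y = C.spans y
            mn = [ m , n ] ∘ splitAt r
        in mn , G×H.trans (combination-basis mn)
          ( G.trans (combination-cong G {g = B.basis} (λ i → cong [ m , n ] (Fin.splitAt-↑ˡ r i s)) (λ _ → refl)) m≈x
          , H.trans (combination-cong H {g = C.basis} (λ j → cong [ m , n ] (Fin.splitAt-↑ʳ r s j)) (λ _ → refl)) n≈y)
    ; independent = λ n (x , y) eq i →
        let eq₁ , eq₂ = G×H.trans (G×H.sym (combination-basis n)) eq
        in ≡.subst (λ i → p ∣ n i) (Fin.join-splitAt r s i)
          ([_,_] {C = λ i → p ∣ n (Fin.join r s i)}
            (B.independent (λ i → n (i ↑ˡ s)) x (G.trans eq₁ (×-homo {G = G×H} {H = G} proj₁-homo p (x , y))))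
            (C.independent (λ j → n (r ↑ʳ j)) y (H.trans eq₂ (×-homo {G = G×H} {H = H} proj₂-homo p (x , y))))
            (splitAt r i))
    }
    where
    module B = HasBasis B
    module C = HasBasis C
    basis : Fin (r ℕ.+ s) → G×H.Carrier
    basis = [ (λ i → B.basis i , H.ε) , (λ j → G.ε , C.basis j) ] ∘ splitAt r
    combination-basis : ∀ n → combination G×H n basis G×H.≈
      (combination G (λ i → n (i ↑ˡ s)) B.basis , combination H (λ j → n (r ↑ʳ j)) C.basis)
    combination-basis n
      = G.trans (combination-homo {G = G×H} {H = G} proj₁-homo n basis)
          (G.trans (combination-cong G {m = n} {g = proj₁ ∘ basis} (λ _ → refl) (λ i → [,]-∘ proj₁ (splitAt r i)))
            (G.trans (combination-splitAt G n B.basis (λ _ → G.ε))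
              (G.trans (G.∙-congˡ (combination-ε G (λ j → n (r ↑ʳ j)))) (G.identityʳ _))))
      , H.trans (combination-homo {G = G×H} {H = H} proj₂-homo n basis)
          (H.trans (combination-cong H {m = n} {g = proj₂ ∘ basis} (λ _ → refl) (λ i → [,]-∘ proj₂ (splitAt r i)))
            (H.trans (combination-splitAt H n (λ _ → H.ε) C.basis)
              (H.trans (H.∙-congʳ (combination-ε H (λ i → n (i ↑ˡ s)))) (H.identityˡ _))))

Π : {I : Set b} → (I → AbelianGroup a ℓ) → AbelianGroup (b ⊔ a) (b ⊔ ℓ)
Π {I = I} G = record
  { Carrier = ∀ i → Carrier (G i)
  ; _≈_     = λ f g → ∀ i → _≈_ (G i) (f i) (g i)
  ; _∙_     = λ f g i → _∙_ (G i) (f i) (g i)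
  ; ε       = λ i → ε (G i)
  ; _⁻¹     = λ f i → _⁻¹ (G i) (f i)
  ; isAbelianGroup = record
    { isGroup = record
      { isMonoid = record
        { isSemigroup = record
          { isMagma = record
            { isEquivalence = record
              { refl  = λ i → AbelianGroup.refl (G i)
              ; sym   = λ eq i → AbelianGroup.sym (G i) (eq i)
              ; trans = λ eq eq′ i → AbelianGroup.trans (G i) (eq i) (eq′ i)
              }
            ; ∙-cong = λ eq eq′ i → ∙-cong (G i) (eq i) (eq′ i)
            }
          ; assoc = λ f g h i → assoc (G i) (f i) (g i) (h i)
          }
        ; identity = (λ f i → identityˡ (G i) (f i)) , λ f i → identityʳ (G i) (f i)
        }
      ; inverse = (λ f i → inverseˡ (G i) (f i)) , λ f i → inverseʳ (G i) (f i)
      ; ⁻¹-cong = λ eq i → ⁻¹-cong (G i) (eq i)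
      }
    ; comm = λ f g i → comm (G i) (f i) (g i)
    }
  }
  where open AbelianGroup

rankℤ≡ : ∀ {c ℓ m ℓm} {R : CommutativeRing c ℓ} (M : Module R m ℓm) F {p r} .{{_ : ℕ.NonTrivial p}} →
         HasBasis (Module.+ᴹ-abelianGroup M) p r → rankℤ M F ≡ r
rankℤ≡ M F B = hasBasis⇒rank (Module.+ᴹ-abelianGroup M) F B
  (proj₂ (RankExists.rankExists (Module.+ᴹ-abelianGroup M) F))

-- Ranks of spline modules on trees

module _ {S : Set a} (r : S → ℕ) where

  -- The total of `r` over all edge labels. The recursion follows `forestOf`, so that on a word (α u
  -- )α v it reduces to `r α` plus the weights of u and v.
  weight : List (S × Tree S) → ℕ
  weight []                   = 0
  weight ((α , node us) ∷ ts) = r α ℕ.+ (weight us ℕ.+ weight ts)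

  wordWeight : DyckWord S → ℕ
  wordWeight (mkDyckWord d) = weight (forestOf d)

module _ {c ℓ} (R : CommutativeRing c ℓ) {N : ℕ} (finite : HasOrder R N) where
  open FiniteRing R finite
  open CommutativeRing R hiding (zero) renaming (refl to ≈-refl; sym to ≈-sym; trans to ≈-trans)
  open Inverse finite using (to; from; to-cong; strictlyInverseˡ; strictlyInverseʳ)
  open RingProperties ring using (-1*x≈-x; -‿+-comm)
  open AbelianGroupProperties +-abelianGroup using (identityˡ-unique; ∙-cancelˡ; ⁻¹-injective; ⁻¹-involutive)
  open CommutativeSemigroupProperties +-commutativeSemigroup using (interchange)
  open CommutativeMonoidMult +-commutativeMonoid using () renaming (_×_ to _×ℕ_)
  open CommutativeMonoidSum +-commutativeMonoid 
    using (sum-permute; sum-cong-≋; ∑-distrib-+; sum-replicate) renaming (sum to ⨁)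
  open SetoidReasoning setoid

  to-injective : ∀ {x y} → to x ≡ to y → x ≈ y
  to-injective {x} {y} eq = ≈-trans (≈-sym (strictlyInverseʳ x))
    (≈-trans (reflexive (cong from eq)) (strictlyInverseʳ y))

  -- Translation by x permutes R.

  order×≈0 : ∀ x → N ×ℕ x ≈ 0#
  order×≈0 x = identityˡ-unique (N ×ℕ x) (⨁ from) (begin
    N ×ℕ x + ⨁ from                  ≈⟨ +-congʳ (sum-replicate N) ⟨
    ⨁ {N} (λ _ → x) + ⨁ from         ≈⟨ ∑-distrib-+ (λ _ → x) from ⟨
    ⨁ (λ i → x + from i)             ≈⟨ sum-cong-≋ (λ i → strictlyInverseʳ (x + from i)) ⟨
    ⨁ (λ i → from (to (x + from i))) ≈⟨ sum-permute from translation ⟨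
    ⨁ from                           ∎)
    where
    cancel : ∀ u v → u + v ≈ 0# → ∀ i → to (u + from (to (v + from i))) ≡ i
    cancel u v u+v≈0 i = ≡.trans (to-cong (begin
      u + from (to (v + from i))  ≈⟨ +-congˡ (strictlyInverseʳ _) ⟩
      u + (v + from i)            ≈⟨ +-assoc u v (from i) ⟨
      (u + v) + from i            ≈⟨ +-congʳ u+v≈0 ⟩
      0# + from i                 ≈⟨ +-identityˡ (from i) ⟩
      from i                      ∎)) (strictlyInverseˡ i)
    translation = permutation (λ i → to (x + from i)) (λ i → to (- x + from i))
      (cancel x (- x) (-‿inverseʳ x)) (cancel (- x) x (-‿inverseˡ x))

  idealGroup : Ideal → AbelianGroup c ℓ
  idealGroup I = record
    { Carrier = ∃ λ x → x ∈ᴿ Ideal.subset I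
    ; _≈_     = λ (x , _) (y , _) → x ≈ y
    ; _∙_     = λ (x , x∈) (y , y∈) → x + y , +-closed x∈ y∈
    ; ε       = 0# , 0∈
    ; _⁻¹     = λ (x , x∈) → - x , ∈ᴿ-resp (Ideal.subset I) (-1*x≈-x x) (*-closed (- 1#) x∈)
    ; isAbelianGroup = record
      { isGroup = record
        { isMonoid = record
          { isSemigroup = record
            { isMagma = record
              { isEquivalence = record { refl = ≈-refl ; sym = ≈-sym ; trans = ≈-trans }
              ; ∙-cong = +-cong
              }
            ; assoc = λ _ _ _ → +-assoc _ _ _
            }
          ; identity = (λ _ → +-identityˡ _) , λ _ → +-identityʳ _
          }
        ; inverse = (λ _ → -‿inverseˡ _) , λ _ → -‿inverseʳ _
        ; ⁻¹-cong = -‿cong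
        }
      ; comm = λ _ _ → +-comm _ _
      }
    }
    where open IsIdeal (ideal-isIdeal I)

  ideal-finite : ∀ I → FiniteCover (AbelianGroup.setoid (idealGroup I))
  ideal-finite I = record
    { size       = N
    ; elem       = elem
    ; index      = to ∘ proj₁
    ; elem-index = elem-index
    ; _≟_        = λ (x , _) (y , _) → map′ to-injective to-cong (to x Fin.≟ to y)
    }
    where
    elem : Fin N → ∃ λ x → x ∈ᴿ Ideal.subset I
    elem i with i ∈ˢ? Ideal.subset I
    ... | yes i∈ = from i , ≡.subst (_∈ˢ Ideal.subset I) (≡.sym (strictlyInverseˡ i)) i∈
    -- Indices outside the ideal fall back to zero, since a cover may repeat elements.
    ... | no  _  = 0# , IsIdeal.0∈ (ideal-isIdeal I)
    elem-index : ∀ ((x , x∈) : ∃ λ x → x ∈ᴿ Ideal.subset I) → proj₁ (elem (to x)) ≈ x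
    elem-index (x , x∈) with to x ∈ˢ? Ideal.subset I
    ... | yes _  = strictlyInverseʳ x
    ... | no  x∉ = contradiction x∈ x∉

  ring-finite : FiniteCover (AbelianGroup.setoid +-abelianGroup)
  ring-finite = record
    { size = N ; elem = from ; index = to ; elem-index = strictlyInverseʳ
    ; _≟_ = λ x y → map′ to-injective to-cong (to x Fin.≟ to y) }

  inclusion-homo : ∀ I → MonoidMorphisms.IsMonoidHomomorphism (AbelianGroup.rawMonoid (idealGroup I)) +-rawMonoid proj₁
  inclusion-homo I = record
    { isMagmaHomomorphism = record
      { isRelHomomorphism = record { cong = λ eq → eq } ; homo = λ _ _ → ≈-refl }
    ; ε-homo = ≈-refl
    }

  -- The direct sum of the edge ideals. As a tree has finitely many edges, it is the group of all
  -- choices of one element for each edge.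
  sections : Tree Ideal → AbelianGroup c (c ⊔ ℓ)
  sections t = Π {I = Edge t} (λ e → idealGroup (label e))

  splines : Tree Ideal → AbelianGroup c (c ⊔ ℓ)
  splines t = Module.+ᴹ-abelianGroup (Spl t)

  -- A potential with prescribed differences, parent minus child. A tree has no cycles, so the
  -- differences need not satisfy any compatibility condition.
  integrate : ∀ {t : Tree Ideal} → Carrier → (Edge t → Carrier) → Vertex t → Carrier
  integrate x δ root        = x
  integrate x δ (below i v) = integrate (x - δ (top i)) (δ ∘ below i) v

  x-[x-y]≈y : ∀ x y → x - (x - y) ≈ y
  x-[x-y]≈y x y = begin
    x - (x - y)        ≈⟨ +-congˡ (-‿+-comm x (- y)) ⟨
    x + (- x - - y)    ≈⟨ +-assoc x (- x) (- - y) ⟨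
    (x - x) - - y      ≈⟨ +-cong (-‿inverseʳ x) (⁻¹-involutive y) ⟩
    0# + y             ≈⟨ +-identityˡ y ⟩
    y                  ∎

  integrate-difference : ∀ {t : Tree Ideal} x (δ : Edge t → Carrier) (e : Edge t) →
    integrate x δ (parent e) - integrate x δ (child e) ≈ δ e
  integrate-difference x δ (top i)     = x-[x-y]≈y x (δ (top i))
  integrate-difference x δ (below i e) = integrate-difference (x - δ (top i)) (δ ∘ below i) e

  -- A tree is connected: the values spread from the root along the edges.
  ≈-from-differences : ∀ {t : Tree Ideal} (f g : Vertex t → Carrier) → f root ≈ g root →
    (∀ e → f (parent e) - f (child e) ≈ g (parent e) - g (child e)) → ∀ v → f v ≈ g v
  ≈-from-differences f g root≈ diff≈ root        = root≈
  ≈-from-differences f g root≈ diff≈ (below i v) = ≈-from-differences (f ∘ below i) (g ∘ below i)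
    (⁻¹-injective (∙-cancelˡ (f root) _ _ (≈-trans (diff≈ (top i)) (+-congʳ (≈-sym root≈)))))
    (diff≈ ∘ below i) v

  module _ {p : ℕ} (k : ℕ) (p-prime : Prime p) (N≡p^k : N ≡ p ^ k) where

    p^k×≈0 : ∀ x → (p ^ k) ×ℕ x ≈ 0#
    p^k×≈0 = ≡.subst (λ n → ∀ x → n ×ℕ x ≈ 0#) N≡p^k order×≈0

    ring-hasBasis : ∃ (HasBasis +-abelianGroup p)
    ring-hasBasis = let r , r-isRank = RankExists.rankExists +-abelianGroup ring-finite in
      r , rank⇒hasBasis +-abelianGroup ring-finite k p-prime p^k×≈0 r-isRank

    ideal-hasBasis : ∀ I → ∃ (HasBasis (idealGroup I) p)
    ideal-hasBasis I = let r , r-isRank = RankExists.rankExists (idealGroup I) (ideal-finite I) in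
      r , rank⇒hasBasis (idealGroup I) (ideal-finite I) k p-prime
        -- Multiples in the ideal are multiples in R, which p ^ k annihilates.
        (λ x → ≈-trans (×-homo {G = idealGroup I} {H = +-abelianGroup} (inclusion-homo I) (p ^ k) x) (p^k×≈0 (proj₁ x)))
        r-isRank

  module _ {p r} (ring-hasBasis : HasBasis +-abelianGroup p r)
           (idealRank : Ideal → ℕ) (ideal-hasBasis : ∀ I → HasBasis (idealGroup I) p (idealRank I)) where

    -- Induction on the forest. Its edges are the first top edge, the edges below it, and those of
    -- the remaining forest with positions shifted by one; sections split accordingly into three
    -- factors.
    sections-hasBasis : ∀ ts → HasBasis (sections (node ts)) p (weight idealRank ts)
    sections-hasBasis []                   = trivial-hasBasis (sections (node [])) p λ { _ (top ()) ; _ (below () _) }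
    sections-hasBasis ((α , node us) ∷ ts) =
      hasBasis-iso {G = sections (node ((α , node us) ∷ ts))} {H = parts} restrict-iso
        (hasBasis-× {G = idealGroup α} {H = DirectProduct.abelianGroup (sections (node us)) (sections (node ts))}
          (ideal-hasBasis α)
          (hasBasis-× {G = sections (node us)} {H = sections (node ts)} (sections-hasBasis us) (sections-hasBasis ts)))
      where
      whole = sections (node ((α , node us) ∷ ts))
      parts = DirectProduct.abelianGroup (idealGroup α)
        (DirectProduct.abelianGroup (sections (node us)) (sections (node ts)))
      module W = AbelianGroup whole
      module P = AbelianGroup parts
      shift : Edge (node ts) → Edge (node ((α , node us) ∷ ts))
      shift (top i)     = top (suc i)
      shift (below i e) = below (suc i) e
      restrict : W.Carrier → P.Carrier
      restrict σ = σ (top zero) , (λ e → σ (below zero e)) ,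
        λ { (top i) → σ (top (suc i)) ; (below i e) → σ (below (suc i) e) }
      extend : P.Carrier → W.Carrier
      extend (a , σ , τ) (top zero)        = a
      extend (a , σ , τ) (top (suc i))     = τ (top i)
      extend (a , σ , τ) (below zero e)    = σ e
      extend (a , σ , τ) (below (suc i) e) = τ (below i e)
      restrict-cong : ∀ {σ τ} → σ W.≈ τ → restrict σ P.≈ restrict τ
      restrict-cong {σ} {τ} eq = eq (top zero) , (λ e → eq (below zero e)) ,
        λ { (top i) → eq (top (suc i)) ; (below i e) → eq (below (suc i) e) }
      restrict-extend : ∀ x → restrict (extend x) P.≈ x
      restrict-extend (a , σ , τ) = ≈-refl , (λ _ → ≈-refl) , λ { (top i) → ≈-refl ; (below i e) → ≈-refl }
      restrict-iso : MonoidMorphisms.IsMonoidIsomorphism W.rawMonoid P.rawMonoid restrict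
      restrict-iso = record
        { isMonoidMonomorphism = record
          { isMonoidHomomorphism = record
            { isMagmaHomomorphism = record
              { isRelHomomorphism = record { cong = restrict-cong }
              ; homo = λ σ τ → ≈-refl , (λ _ → ≈-refl) , λ { (top i) → ≈-refl ; (below i e) → ≈-refl }
              }
            ; ε-homo = ≈-refl , (λ _ → ≈-refl) , λ { (top i) → ≈-refl ; (below i e) → ≈-refl }
            }
          ; injective = λ (eq₁ , eq₂ , eq₃) → λ where
              (top zero)        → eq₁
              (top (suc i))     → eq₃ (top i)
              (below zero e)    → eq₂ e
              (below (suc i) e) → eq₃ (below i e)
          }
        ; surjective = λ x → extend x , λ {z} z≈ →
            P.trans {i = restrict z} {j = restrict (extend x)} {k = x} (restrict-cong z≈) (restrict-extend x)
        }

    spline-hasBasis : ∀ ts → HasBasis (splines (node ts)) p (r ℕ.+ weight idealRank ts)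
    spline-hasBasis ts = hasBasis-iso {G = splines (node ts)} {H = R×sections} differences-iso
      (hasBasis-× {G = +-abelianGroup} {H = sections (node ts)} ring-hasBasis (sections-hasBasis ts))
      where
      R×sections = DirectProduct.abelianGroup +-abelianGroup (sections (node ts))
      module S = AbelianGroup (splines (node ts))
      module P = AbelianGroup R×sections
      differences : S.Carrier → P.Carrier
      differences (mkSpline f f∈) = f root , λ e → f (parent e) - f (child e) , f∈ e
      differences-cong : ∀ {f g} → f S.≈ g → differences f P.≈ differences g
      differences-cong {mkSpline f _} {mkSpline g _} eq = eq root , λ e → +-cong (eq (parent e)) (-‿cong (eq (child e)))
      potential : P.Carrier → Vertex (node ts) → Carrier
      potential (x , δ) = integrate x (proj₁ ∘ δ)
      potential-difference : ∀ y e → potential y (parent e) - potential y (child e) ≈ proj₁ (proj₂ y e)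
      potential-difference (x , δ) = integrate-difference x (proj₁ ∘ δ)
      fromSection : P.Carrier → S.Carrier
      fromSection y = mkSpline (potential y) λ e →
        ∈ᴿ-resp (Ideal.subset (label e)) (≈-sym (potential-difference y e)) (proj₂ (proj₂ y e))
      differences-iso : MonoidMorphisms.IsMonoidIsomorphism S.rawMonoid P.rawMonoid differences
      differences-iso = record
        { isMonoidMonomorphism = record
          { isMonoidHomomorphism = record
            { isMagmaHomomorphism = record
              { isRelHomomorphism = record { cong = λ {f} {g} → differences-cong {f} {g} }
              ; homo = λ (mkSpline f _) (mkSpline g _) → ≈-refl , λ e →
                  ≈-trans (+-congˡ (≈-sym (-‿+-comm (f (child e)) (g (child e)))))
                    (interchange (f (parent e)) (g (parent e)) (- f (child e)) (- g (child e)))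
              }
            ; ε-homo = ≈-refl , λ e → -‿inverseʳ 0#
            }
          ; injective = λ {f} {g} (root≈ , diff≈) → ≈-from-differences (Spline.value f) (Spline.value g) root≈ diff≈
          }
        ; surjective = λ y → fromSection y , λ {g} g≈ →
            P.trans {i = differences g} {j = differences (fromSection y)} {k = y} (differences-cong {g} {fromSection y} g≈)
              (≈-refl , potential-difference y)
        }

    rankSpl≡ : .{{_ : ℕ.NonTrivial p}} → ∀ ts → rankSpl (node ts) ≡ r ℕ.+ weight idealRank ts
    rankSpl≡ ts = rankℤ≡ (Spl (node ts)) (Spl-finite (node ts)) (spline-hasBasis ts)

-- Sums over Dyck words, decomposed at the first bracket

∑-unique : {P : Pred A ℓ} (E E′ : Enumeration P) (f : A → ℕ) → ∑ E f ≡ ∑ E′ f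
∑-unique E E′ f = sum-↭ (map⁺ f (∼bag⇒↭ (unique∧set⇒bag E.unique E′.unique
  (mk⇔ (E′.complete ∘ E.sound) (E.complete ∘ E′.sound)))))
  where
  module E = Enumeration E
  module E′ = Enumeration E′

sum-map-concatMap : ∀ (f : B → ℕ) (g : A → List B) xs →
                    sum (map f (concatMap g xs)) ≡ sum (map (λ x → sum (map f (g x))) xs)
sum-map-concatMap f g []       = refl
sum-map-concatMap f g (x ∷ xs) = ≡.trans (cong sum (List.map-++ f (g x) (concatMap g xs)))
  (≡.trans (sum-++ (map f (g x)) _) (cong (sum (map f (g x)) ℕ.+_) (sum-map-concatMap f g xs)))

sum-map-cartesianProductWith : ∀ (f : C → ℕ) (h : A → B → C) xs ys →
  sum (map f (cartesianProductWith h xs ys)) ≡ sum (map (λ x → sum (map (λ y → f (h x y)) ys)) xs)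
sum-map-cartesianProductWith f h []       ys = refl
sum-map-cartesianProductWith f h (x ∷ xs) ys = ≡.trans
  (cong sum (List.map-++ f (map (h x) ys) _))
  (≡.trans (sum-++ (map f (map (h x) ys)) _)
    (cong₂ ℕ._+_ (cong sum (≡.sym (List.map-∘ ys))) (sum-map-cartesianProductWith f h xs ys)))

sum-map-const : ∀ k (xs : List A) → sum (map (λ _ → k) xs) ≡ length xs ℕ.* k
sum-map-const k []       = refl
sum-map-const k (x ∷ xs) = cong (k ℕ.+_) (sum-map-const k xs)

sum-map-+ : ∀ (f g : A → ℕ) xs → sum (map (λ x → f x ℕ.+ g x) xs) ≡ sum (map f xs) ℕ.+ sum (map g xs)
sum-map-+ f g []       = refl
sum-map-+ f g (x ∷ xs) = ≡.trans (cong (f x ℕ.+ g x ℕ.+_) (sum-map-+ f g xs))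
  (interchange (f x) (g x) _ _)
  where open CommutativeSemigroupProperties ℕ.+-commutativeSemigroup using (interchange)

sum-map-* : ∀ (f : A → ℕ) k xs → sum (map (λ x → f x ℕ.* k) xs) ≡ sum (map f xs) ℕ.* k
sum-map-* f k []       = refl
sum-map-* f k (x ∷ xs) = ≡.trans (cong (f x ℕ.* k ℕ.+_) (sum-map-* f k xs))
  (≡.sym (ℕ.*-distribʳ-+ k (f x) (sum (map f xs))))

sum-map-cong : ∀ {f g : A → ℕ} → (∀ x → f x ≡ g x) → ∀ xs → sum (map f xs) ≡ sum (map g xs)
sum-map-cong f≗g xs = cong sum (List.map-cong f≗g xs)

convolution : (ℕ → ℕ) → (ℕ → ℕ) → ℕ → ℕ
convolution F G n = sum (map (λ i → F (toℕ i) ℕ.* G (n ℕ.∸ toℕ i)) (allFin (suc n)))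

module _ {S : Set a} where

  nestWord : S → DyckWord S × DyckWord S → DyckWord S
  nestWord α (mkDyckWord d , mkDyckWord e) = mkDyckWord (nest α d e)

  -- The bracket that closes the first letter is determined by the word, by `Dyck-prefix`, and with
  -- it both inner words.
  nestWord-injective : ∀ {α β x y} → nestWord α x ≡ nestWord β y → α ≡ β × x ≡ y
  nestWord-injective {x = mkDyckWord {u} d , mkDyckWord {v} e} {y = mkDyckWord {u′} d′ , mkDyckWord {v′} e′} eq
    with List.∷-injective (cong DyckWord.word eq)
  ... | refl , eq₁ with Dyck-prefix d d′ eq₁
  ... | u≡u′ , v≡v′ = refl , cong₂ _,_ (Dyck-irrelevant′ d d′ u≡u′) (Dyck-irrelevant′ e e′ v≡v′)

  size : DyckWord S → ℕ
  size w = ∣E∣ (T w)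

  size-nestWord : ∀ α d e → size (nestWord α (d , e)) ≡ suc (size d ℕ.+ size e)
  size-nestWord α (mkDyckWord d) (mkDyckWord e) = refl

  module _ (E : ∀ n → Enumeration (λ (w : DyckWord S) → size w ≡ n))
           (letters : List S) (letters-unique : Unique letters) (∈-letters : ∀ α → α ∈ letters) where
    private
      words : ℕ → List (DyckWord S)
      words n = Enumeration.elements (E n)

    block : ∀ n → Fin (suc n) → List (DyckWord S)
    block n i = cartesianProductWith nestWord letters (cartesianProduct (words (toℕ i)) (words (n ℕ.∸ toℕ i)))

    emptyWord : Enumeration (λ (w : DyckWord S) → size w ≡ 0)
    emptyWord = record
      { elements = mkDyckWord empty ∷ []
      ; unique   = [] AllPairs.∷ AllPairs.[]
      ; sound    = λ { (here refl) → refl }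
      ; complete = λ { {mkDyckWord empty} _ → here refl }
      }

    -- The outer pair accounts for one edge, and the two inner words share the other n. Blocks with
    -- different i are disjoint, because a word determines the size of the part inside its first
    -- pair.
    nestedWords : ∀ n → Enumeration (λ (w : DyckWord S) → size w ≡ suc n)
    nestedWords n = record
      { elements = concatMap (block n) (allFin (suc n))
      ; unique   = Unique.concat⁺ (All.map⁺ (All.tabulate λ {i} _ → block-unique i))
                     (AllPairs.map⁺ (AllPairs.map (λ i≢j {w} (w∈i , w∈j) → i≢j (block-index w∈i w∈j))
                       (Unique.allFin⁺ (suc n))))
      ; sound    = λ w∈ → let i , w∈i = satisfied (∈-concatMap⁻ (block n) {xs = allFin (suc n)} w∈) in
          block-sound i w∈i
      ; complete = complete
      }
      where
      block-unique : ∀ i → Unique (block n i)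
      block-unique i = Unique.cartesianProductWith⁺ nestWord nestWord-injective letters-unique
        (Unique.cartesianProduct⁺ (Enumeration.unique (E (toℕ i))) (Enumeration.unique (E (n ℕ.∸ toℕ i))))
      block-sound : ∀ i {w} → w ∈ block n i → size w ≡ suc n
      block-sound i w∈ with ∈-cartesianProductWith⁻ nestWord letters _ w∈
      ... | α , (d , e) , α∈ , de∈ , refl =
        let d∈ , e∈ = ∈-cartesianProduct⁻ (words (toℕ i)) (words (n ℕ.∸ toℕ i)) de∈ in
        ≡.trans (size-nestWord α d e) (cong suc (≡.trans
          (cong₂ ℕ._+_ (Enumeration.sound (E (toℕ i)) d∈) (Enumeration.sound (E (n ℕ.∸ toℕ i)) e∈))
          (ℕ.m+[n∸m]≡n (Fin.toℕ≤pred[n] i))))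
      block-index : ∀ {i j w} → w ∈ block n i → w ∈ block n j → i ≡ j
      block-index {i} {j} w∈i w∈j
        with ∈-cartesianProductWith⁻ nestWord letters _ w∈i | ∈-cartesianProductWith⁻ nestWord letters _ w∈j
      ... | α , x , _ , x∈ , refl | β , y , _ , y∈ , eq with nestWord-injective eq
      ... | refl , refl = Fin.toℕ-injective (≡.trans
        (≡.sym (Enumeration.sound (E (toℕ i)) (proj₁ (∈-cartesianProduct⁻ _ _ x∈))))
        (Enumeration.sound (E (toℕ j)) (proj₁ (∈-cartesianProduct⁻ _ _ y∈))))
      complete : ∀ {w} → size w ≡ suc n → w ∈ concatMap (block n) (allFin (suc n))
      complete {mkDyckWord (nest α d e)} eq = ∈-concatMap⁺ (block n)
        (Any.map (λ { refl → ∈-cartesianProductWith⁺ nestWord (∈-letters α)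
          (∈-cartesianProduct⁺ (Enumeration.complete (E (toℕ i)) (≡.sym i≡))
            (Enumeration.complete (E (n ℕ.∸ toℕ i))
              (≡.trans (≡.sym (ℕ.m+n∸m≡n (size (mkDyckWord d)) _)) (cong₂ ℕ._∸_ eq′ (≡.sym i≡))))) })
          (∈-allFin i))
        where
        eq′ : size (mkDyckWord d) ℕ.+ size (mkDyckWord e) ≡ n
        eq′ = ℕ.suc-injective eq
        d<1+n : size (mkDyckWord d) ℕ.< suc n
        d<1+n = ℕ.s≤s (≡.subst (size (mkDyckWord d) ℕ.≤_) eq′ (ℕ.m≤m+n _ _))
        i : Fin (suc n)
        i = fromℕ< d<1+n
        i≡ : toℕ i ≡ size (mkDyckWord d)
        i≡ = Fin.toℕ-fromℕ< d<1+n

    ∑-nested : ∀ n (f : DyckWord S → ℕ) → ∑ (E (suc n)) f ≡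
      sum (map (λ i → sum (map (λ α → sum (map (λ d → sum (map (λ e → f (nestWord α (d , e)))
        (words (n ℕ.∸ toℕ i)))) (words (toℕ i)))) letters)) (allFin (suc n)))
    -- The sum does not depend on the enumeration, so the given one may be exchanged for one that
    -- follows the decomposition.
    ∑-nested n f = ≡.trans (∑-unique (E (suc n)) (nestedWords n) f)
      (≡.trans (sum-map-concatMap f (block n) (allFin (suc n)))
        (sum-map-cong (λ i → ≡.trans (sum-map-cartesianProductWith f nestWord letters _)
          (sum-map-cong (λ α → sum-map-cartesianProductWith (f ∘ nestWord α) _,_ (words (toℕ i)) _) letters))
          (allFin (suc n))))

    count : ℕ → ℕ
    count n = length (words n)

    count-zero : count 0 ≡ 1
    -- A length is read as a sum of ones, so that results about sums over an enumeration apply;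
    -- `count-suc` does the same.
    count-zero = ≡.trans (≡.sym (≡.trans (sum-map-const 1 (words 0)) (ℕ.*-identityʳ _)))
      (∑-unique (E 0) emptyWord (λ _ → 1))

    count-suc : ∀ n → count (suc n) ≡ length letters ℕ.* convolution count count n
    count-suc n = begin
      count (suc n)
        ≡⟨ ℕ.*-identityʳ _ ⟨
      count (suc n) ℕ.* 1
        ≡⟨ sum-map-const 1 (words (suc n)) ⟨
      ∑ (E (suc n)) (λ _ → 1)
        ≡⟨ ∑-nested n (λ _ → 1) ⟩
      _ ≡⟨ sum-map-cong (λ i → ≡.trans (sum-map-cong (λ α → ≡.trans
             (sum-map-cong (λ d → sum-map-const 1 (words (n ℕ.∸ toℕ i))) (words (toℕ i)))
             (≡.trans (sum-map-const _ (words (toℕ i))) (cong (count (toℕ i) ℕ.*_) (ℕ.*-identityʳ _)))) letters)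
             (≡.trans (sum-map-const _ letters) (ℕ.*-comm (length letters) _))) (allFin (suc n)) ⟩
      sum (map (λ i → count (toℕ i) ℕ.* count (n ℕ.∸ toℕ i) ℕ.* length letters) (allFin (suc n)))
        ≡⟨ sum-map-* (λ i → count (toℕ i) ℕ.* count (n ℕ.∸ toℕ i)) (length letters) (allFin (suc n)) ⟩
      convolution count count n ℕ.* length letters
        ≡⟨ ℕ.*-comm _ (length letters) ⟩
      length letters ℕ.* convolution count count n  ∎
      where open ≡.≡-Reasoning

    module _ (r : S → ℕ) where

      total : ℕ → ℕ
      total n = ∑ (E n) (wordWeight r)

      total-zero : total 0 ≡ 0
      total-zero = ∑-unique (E 0) emptyWord (wordWeight r)

      -- A Leibniz rule: in a word (α u )α v the letter adds `r α` for every pair of inner words,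
      -- while the weight of u is counted once for every letter and every v, and likewise for v.
      total-suc : ∀ n → total (suc n) ≡
        sum (map r letters) ℕ.* convolution count count n
          ℕ.+ length letters ℕ.* (convolution total count n ℕ.+ convolution count total n)
      total-suc n = begin
        total (suc n)
          ≡⟨ ∑-nested n (wordWeight r) ⟩
        _ ≡⟨ sum-map-cong inner (allFin (suc n)) ⟩
        sum (map (λ i → cc i ℕ.* sum (map r letters) ℕ.+ (tc i ℕ.+ ct i) ℕ.* length letters) (allFin (suc n)))
          ≡⟨ sum-map-+ (λ i → cc i ℕ.* sum (map r letters)) (λ i → (tc i ℕ.+ ct i) ℕ.* length letters) (allFin (suc n)) ⟩
        sum (map (λ i → cc i ℕ.* sum (map r letters)) (allFin (suc n)))
          ℕ.+ sum (map (λ i → (tc i ℕ.+ ct i) ℕ.* length letters) (allFin (suc n)))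
          ≡⟨ cong₂ ℕ._+_ (≡.trans (sum-map-* cc _ (allFin (suc n))) (ℕ.*-comm _ (sum (map r letters))))
               (≡.trans (sum-map-* (λ i → tc i ℕ.+ ct i) _ (allFin (suc n))) (≡.trans (ℕ.*-comm _ (length letters))
                 (cong (length letters ℕ.*_) (sum-map-+ tc ct (allFin (suc n)))))) ⟩
        sum (map r letters) ℕ.* convolution count count n
          ℕ.+ length letters ℕ.* (convolution total count n ℕ.+ convolution count total n)  ∎
        where
        open ≡.≡-Reasoning
        cc tc ct : Fin (suc n) → ℕ
        cc i = count (toℕ i) ℕ.* count (n ℕ.∸ toℕ i)
        tc i = total (toℕ i) ℕ.* count (n ℕ.∸ toℕ i)
        ct i = count (toℕ i) ℕ.* total (n ℕ.∸ toℕ i)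
        split : ∀ i α →
                sum (map (λ d → sum (map (λ e → wordWeight r (nestWord α (d , e))) (words (n ℕ.∸ toℕ i)))) (words (toℕ i)))
                ≡ r α ℕ.* cc i ℕ.+ (tc i ℕ.+ ct i)
        split i α = begin
          sum (map (λ d → sum (map (λ e → r α ℕ.+ (wordWeight r d ℕ.+ wordWeight r e)) ws)) us)
            ≡⟨ sum-map-cong (λ d → ≡.trans (sum-map-+ (λ _ → r α) (λ e → wordWeight r d ℕ.+ wordWeight r e) ws)
                 (cong₂ ℕ._+_ (sum-map-const (r α) ws) (≡.trans (sum-map-+ (λ _ → wordWeight r d) (wordWeight r) ws)
                   (cong (ℕ._+ total (n ℕ.∸ toℕ i)) (≡.trans (sum-map-const (wordWeight r d) ws) (ℕ.*-comm (length ws) _)))))) us ⟩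
          sum (map (λ d → length ws ℕ.* r α ℕ.+ (wordWeight r d ℕ.* length ws ℕ.+ total (n ℕ.∸ toℕ i))) us)
            ≡⟨ sum-map-+ (λ _ → length ws ℕ.* r α) _ us ⟩
          sum (map (λ _ → length ws ℕ.* r α) us) ℕ.+ sum (map (λ d → wordWeight r d ℕ.* length ws ℕ.+ total (n ℕ.∸ toℕ i)) us)
            ≡⟨ cong₂ ℕ._+_
                 (≡.trans (sum-map-const _ us) (≡.trans (≡.sym (ℕ.*-assoc (length us) (length ws) (r α))) (ℕ.*-comm (cc i) (r α))))
                 (≡.trans (sum-map-+ (λ d → wordWeight r d ℕ.* length ws) (λ _ → total (n ℕ.∸ toℕ i)) us)
                   (cong₂ ℕ._+_ (sum-map-* (wordWeight r) (length ws) us) (sum-map-const _ us))) ⟩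
          r α ℕ.* cc i ℕ.+ (tc i ℕ.+ ct i)  ∎
          where
          us = words (toℕ i)
          ws = words (n ℕ.∸ toℕ i)
        inner : ∀ i →
                sum (map (λ α → sum (map (λ d → sum (map (λ e → wordWeight r (nestWord α (d , e))) (words (n ℕ.∸ toℕ i)))) (words (toℕ i)))) letters)
                ≡ cc i ℕ.* sum (map r letters) ℕ.+ (tc i ℕ.+ ct i) ℕ.* length letters
        inner i = begin
          _ ≡⟨ sum-map-cong (split i) letters ⟩
          sum (map (λ α → r α ℕ.* cc i ℕ.+ (tc i ℕ.+ ct i)) letters)
            ≡⟨ sum-map-+ (λ α → r α ℕ.* cc i) _ letters ⟩
          sum (map (λ α → r α ℕ.* cc i) letters) ℕ.+ sum (map (λ _ → tc i ℕ.+ ct i) letters)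
            ≡⟨ cong₂ ℕ._+_ (≡.trans (sum-map-* r (cc i) letters) (ℕ.*-comm _ (cc i)))
                 (≡.trans (sum-map-const _ letters) (ℕ.*-comm (length letters) _)) ⟩
          cc i ℕ.* sum (map r letters) ℕ.+ (tc i ℕ.+ ct i) ℕ.* length letters  ∎

-- Functional equations of the generating functions

ℕ⇒ℚ-series : (ℕ → ℕ) → PowerSeries
ℕ⇒ℚ-series F n = ℕ⇒ℚ (F n)

-- A general `g` is carried along because the tail of `allFin` tabulates successors and is not
-- itself an `allFin`.
ℕ⇒ℚ-sum : ∀ {n} (f : A → ℕ) (g : Fin n → A) →
          ℕ⇒ℚ (sum (map f (tabulate g))) ≡ RawMonoidDefinitions.sum ℚ.+-0-rawMonoid (λ i → ℕ⇒ℚ (f (g i)))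
ℕ⇒ℚ-sum {n = zero}  f g = refl
ℕ⇒ℚ-sum {n = suc n} f g = ≡.trans (ℕ⇒ℚ-homo-+ (f (g zero)) _) (cong (ℕ⇒ℚ (f (g zero)) ℚ.+_) (ℕ⇒ℚ-sum f (g ∘ suc)))

convolution-⊛ : ∀ F G → ℕ⇒ℚ-series (convolution F G) ≗ ℕ⇒ℚ-series F ⊛ ℕ⇒ℚ-series G
convolution-⊛ F G n = ≡.trans (ℕ⇒ℚ-sum {n = suc n} (λ i → F (toℕ i) ℕ.* G (n ℕ.∸ toℕ i)) (λ i → i))
  (sum-cong-≗ {suc n} λ i → ℕ⇒ℚ-homo-* (F (toℕ i)) (G (n ℕ.∸ toℕ i)))
  where open CommutativeMonoidSum ℚ.+-0-commutativeMonoid using (sum-cong-≗)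

scaled-convolution : ∀ k F G n →
  ℕ⇒ℚ (k ℕ.* convolution F G n) ≡ (constant (ℕ⇒ℚ k) ⊛ (ℕ⇒ℚ-series F ⊛ ℕ⇒ℚ-series G)) n
scaled-convolution k F G n = begin
  ℕ⇒ℚ (k ℕ.* convolution F G n)                                ≡⟨ ℕ⇒ℚ-homo-* k (convolution F G n) ⟩
  ℕ⇒ℚ k ℚ.* ℕ⇒ℚ (convolution F G n)                            ≡⟨ cong (ℕ⇒ℚ k ℚ.*_) (convolution-⊛ F G n) ⟩
  ℕ⇒ℚ k ℚ.* (ℕ⇒ℚ-series F ⊛ ℕ⇒ℚ-series G) n                    ≡⟨ constant-⊛ (ℕ⇒ℚ k) (ℕ⇒ℚ-series F ⊛ ℕ⇒ℚ-series G) n ⟨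
  (constant (ℕ⇒ℚ k) ⊛ (ℕ⇒ℚ-series F ⊛ ℕ⇒ℚ-series G)) n         ∎
  where open ≡.≡-Reasoning

module _ {S : Set a} (E : ∀ n → Enumeration (λ (w : DyckWord S) → size w ≡ n))
         (letters : List S) (letters-unique : Unique letters) (∈-letters : ∀ α → α ∈ letters)
         (r : S → ℕ) where
  private
    D G : ℕ → ℕ
    D = count E letters letters-unique ∈-letters
    G = total E letters letters-unique ∈-letters r
    D̂ Ĝ σ ρ : PowerSeries
    D̂ = ℕ⇒ℚ-series D
    Ĝ = ℕ⇒ℚ-series G
    σ = constant (ℕ⇒ℚ (length letters))
    ρ = constant (ℕ⇒ℚ (sum (map r letters)))

  open ≡.≡-Reasoning

  count-series : D̂ ≗ constant 1ℚ ⊕ 𝕥 ⊛ (σ ⊛ (D̂ ⊛ D̂))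
  count-series zero    = begin
    ℕ⇒ℚ (D 0)                             ≡⟨ cong ℕ⇒ℚ (count-zero E letters letters-unique ∈-letters) ⟩
    1ℚ                                    ≡⟨ ℚ.+-identityʳ 1ℚ ⟨
    1ℚ ℚ.+ 0ℚ                             ≡⟨ cong (1ℚ ℚ.+_) (𝕥-⊛-zero (σ ⊛ (D̂ ⊛ D̂))) ⟨
    1ℚ ℚ.+ (𝕥 ⊛ (σ ⊛ (D̂ ⊛ D̂))) 0         ∎
  count-series (suc n) = begin
    ℕ⇒ℚ (D (suc n))                             ≡⟨ cong ℕ⇒ℚ (count-suc E letters letters-unique ∈-letters n) ⟩
    ℕ⇒ℚ (length letters ℕ.* convolution D D n)  ≡⟨ scaled-convolution (length letters) D D n ⟩
    (σ ⊛ (D̂ ⊛ D̂)) n                            ≡⟨ 𝕥-⊛-suc (σ ⊛ (D̂ ⊛ D̂)) n ⟨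
    (𝕥 ⊛ (σ ⊛ (D̂ ⊛ D̂))) (suc n)                ≡⟨ ℚ.+-identityˡ _ ⟨
    0ℚ ℚ.+ (𝕥 ⊛ (σ ⊛ (D̂ ⊛ D̂))) (suc n)         ∎

  total-series : Ĝ ≗ 𝕥 ⊛ (ρ ⊛ (D̂ ⊛ D̂) ⊕ σ ⊛ (Ĝ ⊛ D̂ ⊕ D̂ ⊛ Ĝ))
  total-series zero    = ≡.trans (cong ℕ⇒ℚ (total-zero E letters letters-unique ∈-letters r))
    (≡.sym (𝕥-⊛-zero (ρ ⊛ (D̂ ⊛ D̂) ⊕ σ ⊛ (Ĝ ⊛ D̂ ⊕ D̂ ⊛ Ĝ))))
  total-series (suc n) = begin
    ℕ⇒ℚ (G (suc n))
      ≡⟨ cong ℕ⇒ℚ (total-suc E letters letters-unique ∈-letters r n) ⟩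
    ℕ⇒ℚ (sum (map r letters) ℕ.* convolution D D n ℕ.+ length letters ℕ.* (convolution G D n ℕ.+ convolution D G n))
      ≡⟨ ℕ⇒ℚ-homo-+ (sum (map r letters) ℕ.* convolution D D n) _ ⟩
    ℕ⇒ℚ (sum (map r letters) ℕ.* convolution D D n)
      ℚ.+ ℕ⇒ℚ (length letters ℕ.* (convolution G D n ℕ.+ convolution D G n))
      ≡⟨ cong₂ ℚ._+_ (scaled-convolution (sum (map r letters)) D D n)
           (≡.trans (ℕ⇒ℚ-homo-* (length letters) (convolution G D n ℕ.+ convolution D G n))
             (cong (ℕ⇒ℚ (length letters) ℚ.*_) (≡.trans (ℕ⇒ℚ-homo-+ (convolution G D n) (convolution D G n))
               (cong₂ ℚ._+_ (convolution-⊛ G D n) (convolution-⊛ D G n))))) ⟩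
    (ρ ⊛ (D̂ ⊛ D̂)) n ℚ.+ ℕ⇒ℚ (length letters) ℚ.* (Ĝ ⊛ D̂ ⊕ D̂ ⊛ Ĝ) n
      ≡⟨ cong ((ρ ⊛ (D̂ ⊛ D̂)) n ℚ.+_) (constant-⊛ (ℕ⇒ℚ (length letters)) (Ĝ ⊛ D̂ ⊕ D̂ ⊛ Ĝ) n) ⟨
    (ρ ⊛ (D̂ ⊛ D̂) ⊕ σ ⊛ (Ĝ ⊛ D̂ ⊕ D̂ ⊛ Ĝ)) n
      ≡⟨ 𝕥-⊛-suc (ρ ⊛ (D̂ ⊛ D̂) ⊕ σ ⊛ (Ĝ ⊛ D̂ ⊕ D̂ ⊛ Ĝ)) n ⟨
    (𝕥 ⊛ (ρ ⊛ (D̂ ⊛ D̂) ⊕ σ ⊛ (Ĝ ⊛ D̂ ⊕ D̂ ⊛ Ĝ))) (suc n)  ∎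

  affine-series : ∀ r₀ (f : DyckWord S → ℕ) → (∀ w → f w ≡ r₀ ℕ.+ wordWeight r w) →
                  (λ n → ℕ⇒ℚ (∑ (E n) f)) ≗ constant (ℕ⇒ℚ r₀) ⊛ D̂ ⊕ Ĝ
  affine-series r₀ f f≗ n = begin
    ℕ⇒ℚ (∑ (E n) f)
      ≡⟨ cong ℕ⇒ℚ (≡.trans (sum-map-cong f≗ words) (≡.trans (sum-map-+ (λ _ → r₀) _ words)
           (cong (ℕ._+ G n) (≡.trans (sum-map-const r₀ words) (ℕ.*-comm (D n) r₀))))) ⟩
    ℕ⇒ℚ (r₀ ℕ.* D n ℕ.+ G n)              ≡⟨ ℕ⇒ℚ-homo-+ (r₀ ℕ.* D n) (G n) ⟩
    ℕ⇒ℚ (r₀ ℕ.* D n) ℚ.+ ℕ⇒ℚ (G n)        ≡⟨ cong (ℚ._+ Ĝ n) (ℕ⇒ℚ-homo-* r₀ (D n)) ⟩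
    ℕ⇒ℚ r₀ ℚ.* D̂ n ℚ.+ Ĝ n                ≡⟨ cong (ℚ._+ Ĝ n) (constant-⊛ (ℕ⇒ℚ r₀) D̂ n) ⟨
    (constant (ℕ⇒ℚ r₀) ⊛ D̂ ⊕ Ĝ) n         ∎
    where words = Enumeration.elements (E n)

theorem4p7 : ∀ {c ℓ} (R : CommutativeRing c ℓ) {N : ℕ} (finite : HasOrder R N)
    (p k : ℕ) → Prime p → N ≡ p ^ k →
    IsAlgebraic (HD R finite)
theorem4p7 R {N} finite p k p-prime N≡p^k =
  algebraic (length letters) (sum (map idealRank letters)) ringRank
    {ℕ⇒ℚ-series (count E letters letters-unique ∈-letters)}
    {ℕ⇒ℚ-series (total E letters letters-unique ∈-letters idealRank)}
    {HD R finite}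
    (count-series E letters letters-unique ∈-letters idealRank)
    (total-series E letters letters-unique ∈-letters idealRank)
    (affine-series E letters letters-unique ∈-letters idealRank ringRank (λ w → rankSpl (T w))
      (λ w → rankSpl≡ R finite (proj₂ (ring-hasBasis R finite k p-prime N≡p^k)) idealRank
        (λ I → proj₂ (ideal-hasBasis R finite k p-prime N≡p^k I)) (forestOf (DyckWord.isDyck w))))
  where
  open FiniteRing R finite
  ringRank : ℕ
  ringRank = proj₁ (ring-hasBasis R finite k p-prime N≡p^k)
  idealRank : Ideal → ℕ
  idealRank I = proj₁ (ideal-hasBasis R finite k p-prime N≡p^k I)
  -- The numbers s and ρ must count every ideal once, and `ideals` carries no proof that its entries
  -- are distinct.
  letters : List Ideal
  letters = deduplicate _≟ᴵ_ ideals
  letters-unique : Unique letters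
  letters-unique = DecUnique.deduplicate-! _≟ᴵ_ ideals
  ∈-letters : ∀ I → I ∈ letters
  ∈-letters I = ∈-deduplicate⁺ _≟ᴵ_ (∈-ideals I)
  E : ∀ n → Enumeration (λ (w : DyckWord Ideal) → size w ≡ n)
  E = dyckWords _≟ᴵ_ ideals ∈-ideals
  instance
    p-nonTrivial : ℕ.NonTrivial p
    p-nonTrivial = prime⇒nonTrivial p-prime
    -- The whole ring is an ideal, so s is not zero.
    letters≢[] : ℕ.NonZero (length letters)
    letters≢[] with letters | ∈-letters (mkIdeal ⊤ (record
      { 0∈ = ∈⊤ ; +-closed = λ _ _ → ∈⊤ ; *-closed = λ _ _ → ∈⊤ }))
    ... | _ ∷ _ | _ = _
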